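{- Let $k\ge 1$, $d\ge k$, $\nu>d$ be integers, and let $i_0,\ldots,i_{k+1}$ be integers with $$i_0=0<i_1<\cdots<i_{k-1}<i_k=d<i_{k+1}=\nu.$$ Let $R^*$ be a positive integer such that $$R^*\cdot\prod_{s\in\{0,\ldots,k\}\setminus\{r\}}\frac{\nu-i_s}{|i_r-i_s|}\Big/\binom{\nu}{i_r}\in\mathbb{N}\quad\text{for all } r\in\{0,\ldots,k\}.$$ Then there exists a regular $(N,D)\in\Delta(\nu,d,k)$ in which, for each $r\in\{0,\ldots,k+1\}$, every Boolean word of length $\nu$ and weight $i_r$ occurs exactly $R^*\cdot\prod_{s\in\{0,\ldots,k\}\setminus\{r\}}\frac{\nu-i_s}{|i_r-i_s|}/\binom{\nu}{i_r}$ times, in $D$ if $r\equiv k\pmod 2$ and in $N$ otherwise, and words of any other weight do not occur in $N$ or $D$. Furthermore, $\delta(\nu,d,k)$ equals the maximum, over all integer sequences $(i_0,\ldots,i_{k+1})$ satisfying $i_0=0<i_1<\cdots<i_{k-1}<i_k=d<i_{k+1}=\nu$, of $$\frac{2}{1+\sum_{r=0}^k \prod_{s=0}^{r-1}\frac{\nu-i_s}{i_r-i_s}\prod_{s=r+1}^{k}\frac{\nu-i_s}{i_s-i_r}}.$$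
   Context: $\Delta(\nu,d,k)$ (for integers $k>0$, $d\ge k$, $\nu\ge d$) is the set of pairs $(N,D)$ of arrays (finite sequences of rows) with $\nu$ columns over $\{0,1\}$ such that: $N$ contains at least one all-ones row; each row of $D$ has at most $d$ non-zero coordinates; and for every choice of $k$ columns, extracting them from $N$ and from $D$ gives the same array up to the order of rows. $R^*(N,D)$ is the number of all-ones rows in $N$, $R(N,D)$ the number of rows of $D$, and $\delta(\nu,d,k)$ the maximum of $R^*(N,D)/R(N,D)$ over $\Delta(\nu,d,k)$. The weight of a Boolean word is its number of non-zero coordinates. A Boolean array is regular if, for each $i$, all words of length $\nu$ and weight $i$ occur in it with the same frequency; $(N,D)$ is regular if both $N$ and $D$ are. -}

module Defs where

open import Data.Nat as ℕ using (ℕ; zero; suc; _∸_; _%_; ∣_-_∣)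
open import Data.Nat.Combinatorics using (_C_)
open import Data.Integer using (+_)
open import Data.Rational as ℚ using (ℚ; 0ℚ; 1ℚ; _÷_)
open import Data.Rational.Properties using () renaming (_≟_ to _≟ℚ_)
open import Data.Bool using (Bool; true; false) renaming (_≟_ to _≟𝔹_)
open import Data.Fin as Fin using (Fin; inject₁; toℕ)
open import Data.Vec as Vec using (Vec; []; _∷_; tabulate; lookup; replicate)
open import Data.Vec.Properties using (≡-dec)
open import Data.List using (List; map; filter; length)
open import Data.List.Relation.Unary.All using (All)
open import Data.List.Membership.Propositional using (_∈_)
open import Data.List.Relation.Binary.Permutation.Propositional using (_↭_)
open import Data.Product using (_×_)
open import Function.Definitions using (Injective)
open import Relation.Binary.PropositionalEquality using (_≡_)
open import Relation.Nullary using (yes; no; does)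
open import Data.Bool using (if_then_else_)

Word : ℕ → Set
Word ν = Vec Bool ν

Array : ℕ → Set
Array ν = List (Word ν)

weight : ∀ {n} → Word n → ℕ
weight []          = 0
weight (true ∷ w)  = suc (weight w)
weight (false ∷ w) = weight w

ones : (ν : ℕ) → Word ν
ones ν = replicate ν true

occ : ∀ {ν} → Array ν → Word ν → ℕ
occ A w = length (filter (λ x → ≡-dec _≟𝔹_ x w) A)

extract : ∀ {ν k} → (Fin k → Fin ν) → Array ν → Array k
extract c A = map (λ w → tabulate (λ j → lookup w (c j))) A

InΔ : (ν d k : ℕ) → Array ν → Array ν → Set
InΔ ν d k N D =
  (ones ν ∈ N)
  × All (λ w → weight w ℕ.≤ d) D
  × (∀ (c : Fin k → Fin ν) → Injective _≡_ _≡_ c → extract c N ↭ extract c D)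

Rstar : ∀ {ν} → Array ν → Array ν → ℕ
Rstar {ν} N D = occ N (ones ν)

R : ∀ {ν} → Array ν → Array ν → ℕ
R N D = length D

Regular : ∀ {ν} → Array ν → Set
Regular {ν} A = ∀ (w w′ : Word ν) → weight w ≡ weight w′ → occ A w ≡ occ A w′

ℕtoℚ : ℕ → ℚ
ℕtoℚ n = (+ n) ℚ./ 1

-- a / b for naturals (only used with b ≠ 0; value 0 when b = 0)
_/ℕ_ : ℕ → ℕ → ℚ
a /ℕ zero  = 0ℚ
a /ℕ suc b = (+ a) ℚ./ suc b

-- p / q for rationals (only used with q ≠ 0; value 0 when q = 0)
_/ℚ_ : ℚ → ℚ → ℚ
p /ℚ q with q ≟ℚ 0ℚ
... | yes _  = 0ℚ
... | no q≢0 = _÷_ p q {{ℚ.≢-nonZero q≢0}}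

Σℚ : (n : ℕ) → (Fin n → ℚ) → ℚ
Σℚ zero    f = 0ℚ
Σℚ (suc n) f = f Fin.zero ℚ.+ Σℚ n (λ s → f (Fin.suc s))

Πℚ : (n : ℕ) → (Fin n → ℚ) → ℚ
Πℚ zero    f = 1ℚ
Πℚ (suc n) f = f Fin.zero ℚ.* Πℚ n (λ s → f (Fin.suc s))

Seq : ℕ → Set
Seq k = Fin (suc (suc k)) → ℕ

Admissible : (ν d k : ℕ) → Seq k → Set
Admissible ν d k i =
  (i Fin.zero ≡ 0)
  × (∀ (r s : Fin (suc (suc k))) → r Fin.< s → i r ℕ.< i s)
  × (i (inject₁ (Fin.fromℕ k)) ≡ d)
  × (i (Fin.fromℕ (suc k)) ≡ ν)

P : (ν k : ℕ) → Seq k → Fin (suc (suc k)) → ℚ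
P ν k i r = Πℚ (suc k) (λ s →
  if does (inject₁ s Fin.≟ r) then 1ℚ
  else ((ν ∸ i (inject₁ s)) /ℕ ∣ i r - i (inject₁ s) ∣))

mult : (ν k : ℕ) → Seq k → ℕ → Fin (suc (suc k)) → ℚ
mult ν k i Rs r = (ℕtoℚ Rs ℚ.* P ν k i r) /ℚ ℕtoℚ (ν C i r)

value : (ν k : ℕ) → Seq k → ℚ
value ν k i = ℕtoℚ 2 /ℚ (1ℚ ℚ.+ Σℚ (suc k) (λ r → P ν k i (inject₁ r)))

ratio : ∀ {ν} → Array ν → Array ν → ℚ
ratio N D = Rstar N D /ℕ R N D

{-# OPTIONS --safe #-}

-- With h = (frequency in N) - (frequency in D), being in Δ(ν,d,k) says that h sums to zero
-- against every function of k columns.  For functions of the weight these are the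
-- polynomials of degree at most k, and for a regular pair nothing else is required.
-- Lagrange interpolation at i_0, ..., i_k evaluated at ν is exactly such a relation, which
-- gives the regular pairs of the first part.
--
-- For the bound, let p be the polynomial of degree k taking the values (-1)^(k-r) at i_r,
-- where (i_r) minimises the sum of the products, which is p(ν).  If |p| exceeded 1 at some
-- integer of [0,d], exchanging it with a neighbouring node would decrease this sum (the end
-- nodes 0 and d never need to move, since p alternates too often to exceed 1 there); so
-- |p| ≤ 1 on [0,d], and p ≥ 0 beyond d.  Summing 1 + p(weight) over the rows of N and of D
-- gives the same value, at least R*(1 + p(ν)) and at most 2R.

module Submission where

open import Defs
open import Data.Nat using (ℕ; suc; _≤_; _<_; _%_)
open import Data.Fin using (Fin; inject₁; toℕ)
open import Data.Rational using () renaming (_≤_ to _≤ℚ_)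
open import Data.Product using (_×_; Σ; ∃; ∃-syntax)
open import Relation.Binary.PropositionalEquality using (_≡_; _≢_)

open import Data.Nat as ℕ using (zero; _∸_; ∣_-_∣; z≤n; s≤s)
import Data.Nat.Properties as ℕₚ
import Data.Nat.Coprimality as Coprime
open import Data.Nat.Combinatorics using (_C_; nCk+nC[k+1]≡[n+1]C[k+1]; nCn≡1; nCk≡nC[n∸k])
import Data.Integer as ℤ
open import Data.Integer using () renaming (+_ to pos)
import Data.Integer.Properties as ℤₚ
open import Data.Rational as ℚ using (ℚ; mkℚ; 0ℚ; 1ℚ; _+_; _*_; -_; _-_; nonNegative; positive; 1/_; ↥_) renaming (_<_ to _<ℚ_)
import Data.Rational.Properties as ℚₚ
import Data.Rational.Unnormalised as ℚᵘ
import Data.Rational.Unnormalised.Properties as ℚᵘₚ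
open import Data.Rational.Solver using (module +-*-Solver)
open import Data.Bool using (Bool; true; false; if_then_else_; not)
import Data.Bool.Properties as Boolₚ
open import Data.Fin as Fin using (zero; suc; fromℕ)
import Data.Fin.Properties as Finₚ
open import Data.Fin.Relation.Unary.Top using (view; ‵fromℕ; ‵inject₁)
open import Data.Vec using (Vec; []; _∷_; lookup; tabulate; insertAt)
import Data.Vec.Properties as Vecₚ
import Data.List as List
open import Data.List using (List; []; _∷_; _++_; map; replicate; length)
import Data.List.Properties as Listₚ
open import Data.List.Membership.Propositional using (_∈_)
open import Data.List.Membership.Propositional.Properties using (∈-∃++; ∈-cartesianProductWith⁺; ∈-upTo⁺; ∈-filter⁺)
open import Data.List.Relation.Unary.Any using (here; there)
open import Data.List.Relation.Unary.All as All using (All)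
import Data.List.Relation.Unary.All.Properties as Allₚ
open import Data.List.Relation.Binary.Permutation.Propositional as ↭ using (_↭_; prep; ↭-sym; ↭-trans)
import Data.List.Relation.Binary.Permutation.Propositional.Properties as ↭ₚ
open import Relation.Binary.Bundles using (DecTotalOrder)
open import Data.List.Extrema (DecTotalOrder.totalOrder ℚₚ.≤-decTotalOrder) using (argmin; argmin-all; f[argmin]≤f[xs])
open import Data.Product using (_,_; proj₁; proj₂)
open import Data.Sum using (_⊎_; inj₁; inj₂)
open import Function.Definitions using (Injective)
open import Relation.Nullary using (¬_; yes; no; does; Dec; contradiction)
open import Relation.Nullary.Decidable using (dec-true; dec-false; _×-dec_; _→-dec_)
open import Relation.Binary.Definitions using (tri<; tri≈; tri>)
open import Relation.Binary.PropositionalEquality using (refl; sym; trans; cong; cong₂; subst; subst₂; module ≡-Reasoning)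
import Relation.Binary.Reasoning.Setoid as ≈-Reasoning

open +-*-Solver using (solve; _:=_; _:+_; _:*_; _:-_; :-_; con)

-- Rational arithmetic

-- The two halves fit together by complementary slackness: `1 + p` is 2 at the weights placed in `D`
-- and 0 at the weights placed in `N` other than `ν`, so the pair built from the minimising sequence
-- turns the bound into an equality. This is why the parity of `r` against `k` decides the array. A
-- single sign principle drives every estimate on `p`. Past the last of `k+1` nodes the Lagrange
-- basis alternates in sign, so a polynomial of degree at most `k` whose node values weakly
-- alternate, ending with a nonnegative one, is nonnegative there, and positive as soon as one node
-- value is nonzero. It serves for comparing `p` with the polynomial of an exchanged sequence, for
-- both end intervals, and for the sign of `p` beyond `d`. The obstacle is the passage between
-- columns and weights. A pair in Δ need not be regular, so for the bound a polynomial in the weight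
-- is expanded into products of at most `k` coordinates. For the construction the passage runs the
-- other way: a prescribed pattern on `k` columns has to become a polynomial condition on the weight
-- alone.

ι : ℕ → ℚ
ι = ℕtoℚ

ι-mk : ∀ n → ι n ≡ mkℚ (pos n) 0 (Coprime.sym (Coprime.1-coprimeTo n))
ι-mk n = ℚₚ.↥p/↧p≡p (mkℚ (pos n) 0 _)

ι-+ : ∀ m n → ι (m ℕ.+ n) ≡ ι m + ι n
ι-+ m n = trans (cong (λ z → z ℚ./ 1) (cong₂ ℤ._+_ (lem m) (lem n))) (sym (cong₂ _+_ (ι-mk m) (ι-mk n)))
  where
  lem : ∀ j → pos j ≡ pos j ℤ.* pos 1
  lem j = sym (ℤₚ.*-identityʳ (pos j))

ι-suc : ∀ n → ι (suc n) ≡ 1ℚ + ι n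
ι-suc n = ι-+ 1 n

ι-injective : ∀ {m n} → ι m ≡ ι n → m ≡ n
ι-injective {m} {n} eq = ℤₚ.+-injective (cong ↥_ (trans (sym (ι-mk m)) (trans eq (ι-mk n))))

0≤ι : ∀ n → 0ℚ ≤ℚ ι n
0≤ι n = ℚₚ.nonNegative⁻¹ (ι n) {{ℚₚ.normalize-nonNeg n 1}}

0<ι-suc : ∀ n → 0ℚ <ℚ ι (suc n)
0<ι-suc n = ℚₚ.positive⁻¹ (ι (suc n)) {{ℚₚ.normalize-pos (suc n) 1}}

0<ι : ∀ {n} → 0 ℕ.< n → 0ℚ <ℚ ι n
0<ι {suc n} _ = 0<ι-suc n

ι-∸ : ∀ {m n} → n ℕ.≤ m → ι (m ∸ n) ≡ ι m - ι n
ι-∸ {m} {n} n≤m = begin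
  ι (m ∸ n)                 ≡⟨ solve 2 (λ a b → a := (a :+ b) :- b) refl (ι (m ∸ n)) (ι n) ⟩
  (ι (m ∸ n) + ι n) - ι n   ≡⟨ cong (_- ι n) (ι-+ (m ∸ n) n) ⟨
  ι (m ∸ n ℕ.+ n) - ι n     ≡⟨ cong (λ z → ι z - ι n) (ℕₚ.m∸n+n≡m n≤m) ⟩
  ι m - ι n                 ∎
  where open ≡-Reasoning

*-pos : ∀ {p q} → 0ℚ <ℚ p → 0ℚ <ℚ q → 0ℚ <ℚ p * q
*-pos {p} {q} 0<p 0<q =
  ℚₚ.positive⁻¹ (p * q) {{ℚₚ.pos*pos⇒pos p {{positive 0<p}} q {{positive 0<q}}}}

*-nonNeg : ∀ {p q} → 0ℚ ≤ℚ p → 0ℚ ≤ℚ q → 0ℚ ≤ℚ p * q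
*-nonNeg {p} {q} 0≤p 0≤q =
  ℚₚ.nonNegative⁻¹ (p * q) {{ℚₚ.nonNeg*nonNeg⇒nonNeg p {{nonNegative 0≤p}} q {{nonNegative 0≤q}}}}

+-nonNeg : ∀ {p q} → 0ℚ ≤ℚ p → 0ℚ ≤ℚ q → 0ℚ ≤ℚ p + q
+-nonNeg = ℚₚ.+-mono-≤

<⇒0<- : ∀ {p q} → p <ℚ q → 0ℚ <ℚ q - p
<⇒0<- {p} {q} p<q = subst (_<ℚ q - p) (ℚₚ.+-inverseʳ p) (ℚₚ.+-monoˡ-< (- p) p<q)

≤⇒0≤- : ∀ {p q} → p ≤ℚ q → 0ℚ ≤ℚ q - p
≤⇒0≤- {p} {q} p≤q = subst (_≤ℚ q - p) (ℚₚ.+-inverseʳ p) (ℚₚ.+-monoˡ-≤ (- p) p≤q)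

-+-cancel : ∀ p q → q - p + p ≡ q
-+-cancel = solve 2 (λ p q → q :- p :+ p := q) refl

0<-⇒< : ∀ {p q} → 0ℚ <ℚ q - p → p <ℚ q
0<-⇒< {p} {q} h = subst₂ _<ℚ_ (ℚₚ.+-identityˡ p) (-+-cancel p q) (ℚₚ.+-monoˡ-< p h)

-≡0⇒≡ : ∀ {p q} → p - q ≡ 0ℚ → p ≡ q
-≡0⇒≡ {p} {q} h = trans (sym (-+-cancel q p)) (trans (cong (_+ q) h) (ℚₚ.+-identityˡ q))

*-cancelʳ : ∀ {r p q} → r ≢ 0ℚ → p * r ≡ q * r → p ≡ q
*-cancelʳ {r} {p} {q} r≢0 eq = trans (lem p) (trans (cong (_* 1/r) eq) (sym (lem q)))
  where
  instance _ = ℚ.≢-nonZero r≢0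
  1/r = 1/ r
  lem : ∀ t → t ≡ t * r * 1/r
  lem t = sym (trans (ℚₚ.*-assoc t r 1/r) (trans (cong (t *_) (ℚₚ.*-inverseʳ r)) (ℚₚ.*-identityʳ t)))

*≡0⇒ʳ≡0 : ∀ {p q} → p ≢ 0ℚ → p * q ≡ 0ℚ → q ≡ 0ℚ
*≡0⇒ʳ≡0 {p} {q} p≢0 eq =
  *-cancelʳ p≢0 (trans (ℚₚ.*-comm q p) (trans eq (sym (ℚₚ.*-zeroˡ p))))

>⇒≢0 : ∀ {p} → 0ℚ <ℚ p → p ≢ 0ℚ
>⇒≢0 0<p p≡0 = ℚₚ.<⇒≢ 0<p (sym p≡0)

/ℕ-* : ∀ a {b} → 0 ℕ.< b → (a /ℕ b) * ι b ≡ ι a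
/ℕ-* a {suc b} _ = ℚₚ.toℚᵘ-injective (begin
  ℚ.toℚᵘ ((pos a ℚ./ suc b) * ι (suc b))                  ≈⟨ ℚₚ.toℚᵘ-homo-* (pos a ℚ./ suc b) (ι (suc b)) ⟩
  ℚ.toℚᵘ (pos a ℚ./ suc b) ℚᵘ.* ℚ.toℚᵘ (ι (suc b))         ≈⟨ ℚᵘₚ.*-cong (ℚₚ.toℚᵘ-fromℚᵘ (ℚᵘ.mkℚᵘ (pos a) b)) (ℚₚ.toℚᵘ-fromℚᵘ (ℚᵘ.mkℚᵘ (pos (suc b)) 0)) ⟩
  ℚᵘ.mkℚᵘ (pos a) b ℚᵘ.* ℚᵘ.mkℚᵘ (pos (suc b)) 0               ≈⟨ ℚᵘ.*≡* lem ⟩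
  ℚᵘ.mkℚᵘ (pos a) 0                                      ≈⟨ ℚₚ.toℚᵘ-fromℚᵘ (ℚᵘ.mkℚᵘ (pos a) 0) ⟨
  ℚ.toℚᵘ (ι a)                                          ∎)
  where
  open ≈-Reasoning ℚᵘₚ.≃-setoid
  lem : (pos a ℤ.* pos (suc b)) ℤ.* pos 1 ≡ pos a ℤ.* pos (suc b ℕ.* 1)
  lem = trans (ℤₚ.*-identityʳ _) (cong (λ z → pos a ℤ.* pos z) (sym (ℕₚ.*-identityʳ (suc b))))

/ℕ-factor : ∀ a {b} → 0 ℕ.< b → a /ℕ b ≡ ι a * (1 /ℕ b)
/ℕ-factor a {b} 0<b = *-cancelʳ (>⇒≢0 (0<ι 0<b)) (trans (/ℕ-* a 0<b) (sym (begin
  ι a * (1 /ℕ b) * ι b    ≡⟨ ℚₚ.*-assoc (ι a) _ _ ⟩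
  ι a * ((1 /ℕ b) * ι b)  ≡⟨ cong (ι a *_) (/ℕ-* 1 0<b) ⟩
  ι a * ι 1               ≡⟨ ℚₚ.*-identityʳ (ι a) ⟩
  ι a                     ∎)))
  where open ≡-Reasoning

0</ℕ : ∀ {a b} → 0 ℕ.< a → 0 ℕ.< b → 0ℚ <ℚ a /ℕ b
0</ℕ {suc a} {suc b} _ _ = ℚₚ.positive⁻¹ _ {{ℚₚ.normalize-pos (suc a) (suc b)}}

/ℕ-refl : ∀ {a} → 0 ℕ.< a → a /ℕ a ≡ 1ℚ
/ℕ-refl {a} 0<a = *-cancelʳ (>⇒≢0 (0<ι 0<a)) (trans (/ℕ-* a 0<a) (sym (ℚₚ.*-identityˡ (ι a))))

/ℚ-* : ∀ p {q} → q ≢ 0ℚ → (p /ℚ q) * q ≡ p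
/ℚ-* p {q} q≢0 with q ℚₚ.≟ 0ℚ
... | yes q≡0 = contradiction q≡0 q≢0
... | no  q≢0′ = trans (ℚₚ.*-assoc p _ q) (trans (cong (p *_) (ℚₚ.*-inverseˡ q {{ℚ.≢-nonZero q≢0′}})) (ℚₚ.*-identityʳ p))

-- Finite sums and products

Σ-cong : ∀ n {f g : Fin n → ℚ} → (∀ r → f r ≡ g r) → Σℚ n f ≡ Σℚ n g
Σ-cong zero    h = refl
Σ-cong (suc n) h = cong₂ _+_ (h zero) (Σ-cong n (λ r → h (suc r)))

Π-cong : ∀ n {f g : Fin n → ℚ} → (∀ r → f r ≡ g r) → Πℚ n f ≡ Πℚ n g
Π-cong zero    h = refl
Π-cong (suc n) h = cong₂ _*_ (h zero) (Π-cong n (λ r → h (suc r)))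

Σ-*ˡ : ∀ n c (f : Fin n → ℚ) → Σℚ n (λ r → c * f r) ≡ c * Σℚ n f
Σ-*ˡ zero    c f = sym (ℚₚ.*-zeroʳ c)
Σ-*ˡ (suc n) c f = trans (cong ((c * f zero) +_) (Σ-*ˡ n c _)) (sym (ℚₚ.*-distribˡ-+ c _ _))

Σ-0 : ∀ n {f : Fin n → ℚ} → (∀ r → f r ≡ 0ℚ) → Σℚ n f ≡ 0ℚ
Σ-0 zero    h = refl
Σ-0 (suc n) h = cong₂ _+_ (h zero) (Σ-0 n (λ r → h (suc r)))

Σ-nonNeg : ∀ n {f : Fin n → ℚ} → (∀ r → 0ℚ ≤ℚ f r) → 0ℚ ≤ℚ Σℚ n f
Σ-nonNeg zero    h = ℚₚ.≤-refl
Σ-nonNeg (suc n) h = +-nonNeg (h zero) (Σ-nonNeg n (λ r → h (suc r)))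

Σ-pos : ∀ n {f : Fin n → ℚ} → (∀ r → 0ℚ ≤ℚ f r) → ∀ t → 0ℚ <ℚ f t → 0ℚ <ℚ Σℚ n f
Σ-pos (suc n) h zero    ft = ℚₚ.+-mono-<-≤ ft (Σ-nonNeg n (λ r → h (suc r)))
Σ-pos (suc n) h (suc t) ft = ℚₚ.+-mono-≤-< (h zero) (Σ-pos n (λ r → h (suc r)) t ft)

Σ-single : ∀ n {f : Fin n → ℚ} t → (∀ r → r ≢ t → f r ≡ 0ℚ) → Σℚ n f ≡ f t
Σ-single (suc n) {f} zero    h = trans (cong (f zero +_) (Σ-0 n (λ r → h (suc r) λ ()))) (ℚₚ.+-identityʳ _)
Σ-single (suc n) {f} (suc t) h = trans (cong₂ _+_ (h zero λ ()) (Σ-single n t (λ r r≢t → h (suc r) (λ eq → r≢t (Finₚ.suc-injective eq))))) (ℚₚ.+-identityˡ _)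

Σ-last : ∀ n (f : Fin (suc n) → ℚ) → Σℚ (suc n) f ≡ Σℚ n (λ r → f (inject₁ r)) + f (fromℕ n)
Σ-last zero    f = trans (ℚₚ.+-identityʳ (f zero)) (sym (ℚₚ.+-identityˡ (f zero)))
Σ-last (suc n) f = trans (cong (f zero +_) (Σ-last n (λ r → f (suc r)))) (sym (ℚₚ.+-assoc (f zero) _ _))

Π-* : ∀ n (f g : Fin n → ℚ) → Πℚ n (λ r → f r * g r) ≡ Πℚ n f * Πℚ n g
Π-* zero    f g = refl
Π-* (suc n) f g = trans (cong ((f zero * g zero) *_) (Π-* n _ _))
  (solve 4 (λ a b c d → a :* b :* (c :* d) := a :* c :* (b :* d)) refl (f zero) (g zero) (Πℚ n λ r → f (suc r)) (Πℚ n λ r → g (suc r)))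

Π-1 : ∀ n {f : Fin n → ℚ} → (∀ r → f r ≡ 1ℚ) → Πℚ n f ≡ 1ℚ
Π-1 zero    h = refl
Π-1 (suc n) h = cong₂ _*_ (h zero) (Π-1 n (λ r → h (suc r)))

Π-0 : ∀ n {f : Fin n → ℚ} t → f t ≡ 0ℚ → Πℚ n f ≡ 0ℚ
Π-0 (suc n) {f} zero    h = trans (cong (_* Πℚ n (λ r → f (suc r))) h) (ℚₚ.*-zeroˡ (Πℚ n (λ r → f (suc r))))
Π-0 (suc n) {f} (suc t) h = trans (cong (f zero *_) (Π-0 n t h)) (ℚₚ.*-zeroʳ (f zero))

Π-pos : ∀ n {f : Fin n → ℚ} → (∀ r → 0ℚ <ℚ f r) → 0ℚ <ℚ Πℚ n f
Π-pos zero    h = ℚₚ.positive⁻¹ 1ℚ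
Π-pos (suc n) h = *-pos (h zero) (Π-pos n (λ r → h (suc r)))

-- Polynomial functions

-- Degree at most `n`, encoded by divided differences instead of coefficients: at every base point
-- the quotient by `x - a` has lower degree. Root counting splits off a root with it, and `moment`
-- uses it at the base point 0.
Poly : ℕ → (ℚ → ℚ) → Set
Poly zero    f = ∀ x y → f x ≡ f y
Poly (suc n) f = ∀ a → ∃[ g ] Poly n g × (∀ x → f x ≡ f a + (x - a) * g x)

Poly-cong : ∀ n {f g} → (∀ x → f x ≡ g x) → Poly n f → Poly n g
Poly-cong zero    f≗g F x y = trans (sym (f≗g x)) (trans (F x y) (f≗g y))
Poly-cong (suc n) f≗g F a with F a
... | q , Q , eq = q , Q , λ x → trans (sym (f≗g x)) (trans (eq x) (cong (_+ (x - a) * q x) (f≗g a)))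

Poly-const : ∀ n c → Poly n (λ _ → c)
Poly-const zero    c x y = refl
Poly-const (suc n) c a = (λ _ → 0ℚ) , Poly-const n 0ℚ ,
  λ x → solve 3 (λ c x a → c := c :+ (x :- a) :* con 0ℚ) refl c x a

Poly-+ : ∀ n {f g} → Poly n f → Poly n g → Poly n (λ x → f x + g x)
Poly-+ zero    F G x y = cong₂ _+_ (F x y) (G x y)
Poly-+ (suc n) {f} {g} F G a with F a | G a
... | p , Pp , eqp | q , Qq , eqq = (λ x → p x + q x) , Poly-+ n Pp Qq ,
  λ x → trans (cong₂ _+_ (eqp x) (eqq x))
    (solve 5 (λ fa ga xa p q → fa :+ xa :* p :+ (ga :+ xa :* q) := fa :+ ga :+ xa :* (p :+ q)) refl
      (f a) (g a) (x - a) (p x) (q x))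

Poly-*ˡ : ∀ n c {f} → Poly n f → Poly n (λ x → c * f x)
Poly-*ˡ zero    c F x y = cong (c *_) (F x y)
Poly-*ˡ (suc n) c {f} F a with F a
... | p , Pp , eqp = (λ x → c * p x) , Poly-*ˡ n c Pp ,
  λ x → trans (cong (c *_) (eqp x))
    (solve 4 (λ c fa xa p → c :* (fa :+ xa :* p) := c :* fa :+ xa :* (c :* p)) refl c (f a) (x - a) (p x))

Poly-- : ∀ n {f g} → Poly n f → Poly n g → Poly n (λ x → f x - g x)
Poly-- n {f} {g} F G = Poly-cong n
  (λ x → solve 2 (λ a b → a :+ (:- con 1ℚ) :* b := a :- b) refl (f x) (g x))
  (Poly-+ n F (Poly-*ˡ n (- 1ℚ) G))

Poly-suc : ∀ n {f} → Poly n f → Poly (suc n) f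
Poly-suc zero    {f} F a = (λ _ → 0ℚ) , (λ _ _ → refl) ,
  λ x → trans (F x a) (solve 2 (λ fa xa → fa := fa :+ xa :* con 0ℚ) refl (f a) (x - a))
Poly-suc (suc n) F a with F a
... | p , Pp , eqp = p , Poly-suc n Pp , eqp

Poly-linear-* : ∀ n b {f} → Poly n f → Poly (suc n) (λ x → (x - b) * f x)
Poly-linear-* zero b {f} F a = f , F , λ x →
  trans (solve 4 (λ x a b fx → (x :- b) :* fx := (a :- b) :* fx :+ (x :- a) :* fx) refl x a b (f x))
        (cong (λ z → (a - b) * z + (x - a) * f x) (F x a))
Poly-linear-* (suc n) b {f} F a with F a
-- From `(x - b) f(x) - (a - b) f(a) = (x - a) f(x) + (a - b) (f(x) - f(a))`.
... | p , Pp , eqp = (λ x → f x + (a - b) * p x)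
  , Poly-+ (suc n) F (Poly-suc n (Poly-*ˡ n (a - b) Pp))
  , λ x → trans (cong ((x - b) *_) (eqp x)) (trans
      (solve 5 (λ x a b fa px →
          (x :- b) :* (fa :+ (x :- a) :* px)
          := (a :- b) :* fa :+ (x :- a) :* ((fa :+ (x :- a) :* px) :+ (a :- b) :* px))
        refl x a b (f a) (p x))
      (cong (λ z → (a - b) * f a + (x - a) * (z + (a - b) * p x)) (sym (eqp x))))

Poly-Σ : ∀ m n {f : Fin n → ℚ → ℚ} → (∀ r → Poly m (f r)) → Poly m (λ x → Σℚ n (λ r → f r x))
Poly-Σ m zero    F = Poly-const m 0ℚ
Poly-Σ m (suc n) F = Poly-+ m (F zero) (Poly-Σ m n (λ r → F (suc r)))

-- The quotient at the first root has degree one less and vanishes at the remaining nodes, because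
-- their differences from that root are nonzero.
Poly-roots : ∀ n {f} → Poly n f → (z : Fin (suc n) → ℚ) → (∀ r s → r ≢ s → z r ≢ z s) →
  (∀ r → f (z r) ≡ 0ℚ) → ∀ y → f y ≡ 0ℚ
Poly-roots zero    F z z-inj f0 y = trans (F y (z zero)) (f0 zero)
Poly-roots (suc n) {f} F z z-inj f0 y with F (z zero)
... | g , G , eq = begin
  f y                                 ≡⟨ eq y ⟩
  f (z zero) + (y - z zero) * g y     ≡⟨ cong₂ (λ p q → p + (y - z zero) * q) (f0 zero) g≡0 ⟩
  0ℚ + (y - z zero) * 0ℚ              ≡⟨ solve 1 (λ t → con 0ℚ :+ t :* con 0ℚ := con 0ℚ) refl (y - z zero) ⟩
  0ℚ                                  ∎
  where
  open ≡-Reasoning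
  g-root : ∀ r → g (z (suc r)) ≡ 0ℚ
  g-root r = *≡0⇒ʳ≡0 (λ h → z-inj (suc r) zero (λ ()) (-≡0⇒≡ h)) (begin
    (z (suc r) - z zero) * g (z (suc r))                ≡⟨ ℚₚ.+-identityˡ _ ⟨
    0ℚ + (z (suc r) - z zero) * g (z (suc r))           ≡⟨ cong (_+ (z (suc r) - z zero) * g (z (suc r))) (f0 zero) ⟨
    f (z zero) + (z (suc r) - z zero) * g (z (suc r))   ≡⟨ eq (z (suc r)) ⟨
    f (z (suc r))                                       ≡⟨ f0 (suc r) ⟩
    0ℚ                                                  ∎)
  g≡0 : g y ≡ 0ℚ
  g≡0 = Poly-roots n G (λ r → z (suc r)) (λ r s r≢s → z-inj (suc r) (suc s) (λ h → r≢s (Finₚ.suc-injective h))) g-root y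

-- Lagrange interpolation at increasing natural nodes

Increasing : ∀ {n} → (Fin n → ℕ) → Set
Increasing x = ∀ r s → r Fin.< s → x r ℕ.< x s

increasing⇒distinct : ∀ {n} {x : Fin n → ℕ} → Increasing x → ∀ r s → r ≢ s → x r ≢ x s
increasing⇒distinct x-inc r s r≢s eq with Finₚ.<-cmp r s
... | tri< r<s _ _ = ℕₚ.<⇒≢ (x-inc r s r<s) eq
... | tri≈ _ r≡s _ = r≢s r≡s
... | tri> _ _ s<r = ℕₚ.<⇒≢ (x-inc s r s<r) (sym eq)

-- The sign of `x r - x s` for increasing nodes. The diagonal is set to 1, so that the product over
-- all `s` counts exactly the nodes above `r`.
sg : ∀ {n} → Fin n → Fin n → ℚ
sg zero    zero    = 1ℚ
sg zero    (suc s) = - 1ℚ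
sg (suc r) zero    = 1ℚ
sg (suc r) (suc s) = sg r s

±1 : ℕ → ℚ
±1 zero    = 1ℚ
±1 (suc n) = - ±1 n

-- For r : Fin n this is (-1)^(n-1-r), so the last sign is +1.
alt : ∀ {n} → Fin n → ℚ
alt {suc n} zero    = ±1 n
alt {suc n} (suc r) = alt r

Π-sg : ∀ n (r : Fin n) → Πℚ n (sg r) ≡ alt r
Π-sg (suc n) zero    = trans (ℚₚ.*-identityˡ _) (lem n)
  where
  lem : ∀ n → Πℚ n (λ _ → - 1ℚ) ≡ ±1 n
  lem zero    = refl
  lem (suc n) = trans (cong ((- 1ℚ) *_) (lem n)) (solve 1 (λ t → (:- con 1ℚ) :* t := :- t) refl (±1 n))
Π-sg (suc n) (suc r) = trans (ℚₚ.*-identityˡ _) (Π-sg n r)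

sg-refl : ∀ {n} (r : Fin n) → sg r r ≡ 1ℚ
sg-refl zero    = refl
sg-refl (suc r) = sg-refl r

sg-< : ∀ {n} {r s : Fin n} → r Fin.< s → sg r s ≡ - 1ℚ
sg-< {r = zero}  {suc s} _ = refl
sg-< {r = suc r} {suc s} (s≤s r<s) = sg-< r<s

sg-> : ∀ {n} {r s : Fin n} → s Fin.< r → sg r s ≡ 1ℚ
sg-> {r = suc r} {zero}  _ = refl
sg-> {r = suc r} {suc s} (s≤s s<r) = sg-> s<r

alt² : ∀ {n} (r : Fin n) → alt r * alt r ≡ 1ℚ
alt² {suc n} zero = lem n
  where
  lem : ∀ n → ±1 n * ±1 n ≡ 1ℚ
  lem zero    = refl
  lem (suc n) = trans (solve 1 (λ t → (:- t) :* (:- t) := t :* t) refl (±1 n)) (lem n)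
alt² (suc r) = alt² r

module Lagrange {k} (x : Fin (suc k) → ℕ) (x-inc : Increasing x) where

  -- For `s` other than `r`, the reciprocal of `x r - x s`, split into a sign and a natural
  -- distance: the signs multiply to `alt r`, and the distances are those of the unsigned products
  -- in `P`.
  κ : Fin (suc k) → Fin (suc k) → ℚ
  κ r s = sg r s * (1 /ℕ ∣ x r - x s ∣)

  basis : Fin (suc k) → ℚ → ℚ
  basis r y = Πℚ (suc k) (λ s → if does (s Fin.≟ r) then 1ℚ else (y - ι (x s)) * κ r s)

  absBasis : Fin (suc k) → ℕ → ℚ
  absBasis r y = Πℚ (suc k) (λ s → if does (s Fin.≟ r) then 1ℚ else ((y ∸ x s) /ℕ ∣ x r - x s ∣))

  dist-pos : ∀ {r s} → s ≢ r → 0 ℕ.< ∣ x r - x s ∣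
  dist-pos {r} {s} s≢r with Finₚ.<-cmp r s
  ... | tri< r<s _ _ = subst (0 ℕ.<_) (sym (ℕₚ.m≤n⇒∣m-n∣≡n∸m (ℕₚ.<⇒≤ (x-inc r s r<s)))) (ℕₚ.m<n⇒0<n∸m (x-inc r s r<s))
  ... | tri≈ _ r≡s _ = contradiction (sym r≡s) s≢r
  ... | tri> _ _ s<r = subst (0 ℕ.<_) (sym (ℕₚ.m≤n⇒∣n-m∣≡n∸m (ℕₚ.<⇒≤ (x-inc s r s<r)))) (ℕₚ.m<n⇒0<n∸m (x-inc s r s<r))

  sg-dist : ∀ {r s} → s ≢ r → ι (x r) - ι (x s) ≡ sg r s * ι ∣ x r - x s ∣
  sg-dist {r} {s} s≢r with Finₚ.<-cmp r s
  ... | tri≈ _ r≡s _ = contradiction (sym r≡s) s≢r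
  ... | tri< r<s _ _ = sym (trans
    (cong₂ _*_ (sg-< r<s) (trans (cong ι (ℕₚ.m≤n⇒∣m-n∣≡n∸m (ℕₚ.<⇒≤ (x-inc r s r<s)))) (ι-∸ (ℕₚ.<⇒≤ (x-inc r s r<s)))))
    (solve 2 (λ a b → (:- con 1ℚ) :* (b :- a) := a :- b) refl (ι (x r)) (ι (x s))))
  ... | tri> _ _ s<r = sym (trans
    (cong₂ _*_ (sg-> s<r) (trans (cong ι (ℕₚ.m≤n⇒∣n-m∣≡n∸m (ℕₚ.<⇒≤ (x-inc s r s<r)))) (ι-∸ (ℕₚ.<⇒≤ (x-inc s r s<r)))))
    (ℚₚ.*-identityˡ (ι (x r) - ι (x s))))

  sg² : ∀ {n} (r s : Fin n) → sg r s * sg r s ≡ 1ℚ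
  sg² zero    zero    = refl
  sg² zero    (suc s) = refl
  sg² (suc r) zero    = refl
  sg² (suc r) (suc s) = sg² r s

  κ-inverse : ∀ {r s} → s ≢ r → (ι (x r) - ι (x s)) * κ r s ≡ 1ℚ
  κ-inverse {r} {s} s≢r = begin
    (ι (x r) - ι (x s)) * κ r s
      ≡⟨ cong (_* κ r s) (sg-dist s≢r) ⟩
    sg r s * ι δ * (sg r s * (1 /ℕ δ))
      ≡⟨ solve 3 (λ a b c → a :* b :* (a :* c) := a :* a :* (c :* b)) refl (sg r s) (ι δ) (1 /ℕ δ) ⟩
    sg r s * sg r s * ((1 /ℕ δ) * ι δ)
      ≡⟨ cong₂ _*_ (sg² r s) (/ℕ-* 1 (dist-pos s≢r)) ⟩
    1ℚ ∎
    where
    open ≡-Reasoning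
    δ = ∣ x r - x s ∣

  basis-diag : ∀ r → basis r (ι (x r)) ≡ 1ℚ
  basis-diag r = Π-1 (suc k) factor
    where
    factor : ∀ s → (if does (s Fin.≟ r) then 1ℚ else (ι (x r) - ι (x s)) * κ r s) ≡ 1ℚ
    factor s with s Fin.≟ r
    ... | yes _   = refl
    ... | no  s≢r = κ-inverse s≢r

  basis-off : ∀ r t → t ≢ r → basis r (ι (x t)) ≡ 0ℚ
  basis-off r t t≢r = Π-0 (suc k) {λ s → if does (s Fin.≟ r) then 1ℚ else (ι (x t) - ι (x s)) * κ r s} t factor
    where
    factor : (if does (t Fin.≟ r) then 1ℚ else (ι (x t) - ι (x t)) * κ r t) ≡ 0ℚ
    factor with t Fin.≟ r
    ... | yes t≡r = contradiction t≡r t≢r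
    ... | no  _   = trans (cong (_* κ r t) (ℚₚ.+-inverseʳ (ι (x t)))) (ℚₚ.*-zeroˡ (κ r t))

  -- Of the `k+1` factors the one at `r` is the constant 1, so only `k` of them are linear.
  basis-poly : ∀ r → Poly k (basis r)
  basis-poly r = skip-one k r (λ s → ι (x s)) (κ r)
    where
    factor-* : ∀ n b c {f} → Poly n f → Poly (suc n) (λ y → (y - b) * c * f y)
    factor-* n b c {f} F = Poly-cong (suc n) (λ y → solve 3 (λ u v w → v :* (u :* w) := u :* v :* w) refl (y - b) c (f y))
      (Poly-*ˡ (suc n) c (Poly-linear-* n b F))
    full : ∀ n (b c : Fin n → ℚ) → Poly n (λ y → Πℚ n (λ s → (y - b s) * c s))
    full zero    b c _ _ = refl
    full (suc n) b c = factor-* n (b zero) (c zero) (full n _ _)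
    skip-one : ∀ n (r : Fin (suc n)) (b c : Fin (suc n) → ℚ) →
      Poly n (λ y → Πℚ (suc n) (λ s → if does (s Fin.≟ r) then 1ℚ else (y - b s) * c s))
    skip-one n       zero    b c = Poly-cong n (λ y → sym (ℚₚ.*-identityˡ _)) (full n (λ s → b (suc s)) (λ s → c (suc s)))
    skip-one (suc n) (suc r) b c = factor-* n (b zero) (c zero) (skip-one n r (λ s → b (suc s)) (λ s → c (suc s)))

  ι-x-distinct : ∀ r s → r ≢ s → ι (x r) ≢ ι (x s)
  ι-x-distinct r s r≢s eq = increasing⇒distinct x-inc r s r≢s (ι-injective eq)

  combine : (Fin (suc k) → ℚ) → ℚ → ℚ
  combine v y = Σℚ (suc k) (λ r → v r * basis r y)

  combine-poly : ∀ v → Poly k (combine v)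
  combine-poly v = Poly-Σ k (suc k) (λ r → Poly-*ˡ k (v r) (basis-poly r))

  combine-node : ∀ v t → combine v (ι (x t)) ≡ v t
  combine-node v t = trans
    (Σ-single (suc k) t (λ r r≢t → trans (cong (v r *_) (basis-off r t (λ h → r≢t (sym h)))) (ℚₚ.*-zeroʳ (v r))))
    (trans (cong (v t *_) (basis-diag t)) (ℚₚ.*-identityʳ (v t)))

  -- The difference from the interpolant has degree at most `k` and the `k+1` distinct nodes as
  -- roots.
  lagrange : ∀ {f} → Poly k f → ∀ y → f y ≡ combine (λ r → f (ι (x r))) y
  lagrange {f} F y = -≡0⇒≡ (Poly-roots k (Poly-- k F (combine-poly v)) (λ r → ι (x r)) ι-x-distinct
    (λ r → trans (cong (λ z → f (ι (x r)) - z) (combine-node v r)) (ℚₚ.+-inverseʳ (v r))) y)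
    where
    v : Fin (suc k) → ℚ
    v r = f (ι (x r))

  module Beyond (y : ℕ) (x<y : ∀ r → x r ℕ.< y) where

    -- Beyond all nodes the numerators `y - x s` are positive, so only the denominators carry a
    -- sign, one factor -1 for each node above `r`.
    basis-abs : ∀ r → basis r (ι y) ≡ alt r * absBasis r y
    basis-abs r = trans (Π-cong (suc k) factor) (trans (Π-* (suc k) (sg r) (λ s → if does (s Fin.≟ r) then 1ℚ else ((y ∸ x s) /ℕ ∣ x r - x s ∣))) (cong (_* absBasis r y) (Π-sg (suc k) r)))
      where
      factor : ∀ s → (if does (s Fin.≟ r) then 1ℚ else (ι y - ι (x s)) * κ r s)
        ≡ sg r s * (if does (s Fin.≟ r) then 1ℚ else ((y ∸ x s) /ℕ ∣ x r - x s ∣))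
      factor s with s Fin.≟ r
      ... | yes refl = sym (cong (_* 1ℚ) (sg-refl s))
      ... | no s≢r = begin
        (ι y - ι (x s)) * (sg r s * (1 /ℕ δ))  ≡⟨ cong (_* κ r s) (sym (ι-∸ (ℕₚ.<⇒≤ (x<y s)))) ⟩
        ι (y ∸ x s) * (sg r s * (1 /ℕ δ))      ≡⟨ solve 3 (λ a b c → a :* (b :* c) := b :* (a :* c)) refl (ι (y ∸ x s)) (sg r s) (1 /ℕ δ) ⟩
        sg r s * (ι (y ∸ x s) * (1 /ℕ δ))      ≡⟨ cong (sg r s *_) (/ℕ-factor (y ∸ x s) (dist-pos s≢r)) ⟨
        sg r s * ((y ∸ x s) /ℕ δ)              ∎
        where
        open ≡-Reasoning
        δ = ∣ x r - x s ∣

    absBasis-pos : ∀ r → 0ℚ <ℚ absBasis r y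
    absBasis-pos r = Π-pos (suc k) factor
      where
      factor : ∀ s → 0ℚ <ℚ (if does (s Fin.≟ r) then 1ℚ else ((y ∸ x s) /ℕ ∣ x r - x s ∣))
      factor s with s Fin.≟ r
      ... | yes _   = ℚₚ.positive⁻¹ 1ℚ
      ... | no  s≢r = 0</ℕ (ℕₚ.m<n⇒0<n∸m (x<y s)) (dist-pos s≢r)

    combine-abs : ∀ v → combine v (ι y) ≡ Σℚ (suc k) (λ r → alt r * v r * absBasis r y)
    combine-abs v = Σ-cong (suc k) (λ r → trans (cong (v r *_) (basis-abs r))
      (solve 3 (λ a b c → b :* (a :* c) := a :* b :* c) refl (alt r) (v r) (absBasis r y)))

    lagrange-abs : ∀ {f} → Poly k f → f (ι y) ≡ Σℚ (suc k) (λ r → alt r * f (ι (x r)) * absBasis r y)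
    lagrange-abs {f} F = trans (lagrange F (ι y)) (combine-abs (λ r → f (ι (x r))))

    alternating⇒nonNeg : ∀ {f} → Poly k f → (∀ r → 0ℚ ≤ℚ alt r * f (ι (x r))) → 0ℚ ≤ℚ f (ι y)
    alternating⇒nonNeg F h = subst (0ℚ ≤ℚ_) (sym (lagrange-abs F))
      (Σ-nonNeg (suc k) (λ r → *-nonNeg (h r) (ℚₚ.<⇒≤ (absBasis-pos r))))

    -- Every term of `lagrange-abs` is nonnegative and the term at `t` is positive. Weak
    -- inequalities at the other nodes matter: in an exchange the two compared polynomials agree at
    -- all nodes but one.
    alternating⇒pos : ∀ {f} → Poly k f → (∀ r → 0ℚ ≤ℚ alt r * f (ι (x r))) →
      ∀ t → 0ℚ <ℚ alt t * f (ι (x t)) → 0ℚ <ℚ f (ι y)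
    alternating⇒pos F h t ht = subst (0ℚ <ℚ_) (sym (lagrange-abs F))
      (Σ-pos (suc k) (λ r → *-nonNeg (h r) (ℚₚ.<⇒≤ (absBasis-pos r))) t (*-pos ht (absBasis-pos t)))

-- Sums over all words of a given length

S : ∀ n → (Word n → ℚ) → ℚ
S zero    ψ = ψ []
S (suc n) ψ = S n (λ w → ψ (true ∷ w)) + S n (λ w → ψ (false ∷ w))

S-cong : ∀ n {ψ χ : Word n → ℚ} → (∀ w → ψ w ≡ χ w) → S n ψ ≡ S n χ
S-cong zero    h = h []
S-cong (suc n) h = cong₂ _+_ (S-cong n (λ w → h (true ∷ w))) (S-cong n (λ w → h (false ∷ w)))

S-+ : ∀ n (ψ χ : Word n → ℚ) → S n (λ w → ψ w + χ w) ≡ S n ψ + S n χ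
S-+ zero    ψ χ = refl
S-+ (suc n) ψ χ = trans (cong₂ _+_ (S-+ n _ _) (S-+ n _ _))
  (solve 4 (λ a b c d → a :+ b :+ (c :+ d) := a :+ c :+ (b :+ d)) refl
    (S n (λ w → ψ (true ∷ w))) (S n (λ w → χ (true ∷ w))) (S n (λ w → ψ (false ∷ w))) (S n (λ w → χ (false ∷ w))))

S-*ˡ : ∀ n c (ψ : Word n → ℚ) → S n (λ w → c * ψ w) ≡ c * S n ψ
S-*ˡ zero    c ψ = refl
S-*ˡ (suc n) c ψ = trans (cong₂ _+_ (S-*ˡ n c _) (S-*ˡ n c _)) (sym (ℚₚ.*-distribˡ-+ c _ _))

S-0 : ∀ n {ψ : Word n → ℚ} → (∀ w → ψ w ≡ 0ℚ) → S n ψ ≡ 0ℚ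
S-0 zero    h = h []
S-0 (suc n) h = cong₂ _+_ (S-0 n (λ w → h (true ∷ w))) (S-0 n (λ w → h (false ∷ w)))

S-Σ : ∀ n m (ψ : Fin m → Word n → ℚ) → S n (λ w → Σℚ m (λ r → ψ r w)) ≡ Σℚ m (λ r → S n (ψ r))
S-Σ n zero    ψ = S-0 n (λ _ → refl)
S-Σ n (suc m) ψ = trans (S-+ n (ψ zero) _) (cong (S n (ψ zero) +_) (S-Σ n m (λ r → ψ (suc r))))

-- `S` is defined by splitting off the first column; `S-pick` has to split off an arbitrary chosen
-- one.
S-insert : ∀ n (j : Fin (suc n)) (ψ : Word (suc n) → ℚ) →
  S (suc n) ψ ≡ S n (λ w → ψ (insertAt w j true)) + S n (λ w → ψ (insertAt w j false))
S-insert n       zero    ψ = refl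
S-insert (suc n) (suc j) ψ = trans
  (cong₂ _+_ (S-insert n j (λ w → ψ (true ∷ w))) (S-insert n j (λ w → ψ (false ∷ w))))
  (solve 4 (λ a b c d → a :+ b :+ (c :+ d) := a :+ c :+ (b :+ d)) refl
    (S n (λ w → ψ (true ∷ insertAt w j true))) (S n (λ w → ψ (true ∷ insertAt w j false)))
    (S n (λ w → ψ (false ∷ insertAt w j true))) (S n (λ w → ψ (false ∷ insertAt w j false))))

weight-insert-true : ∀ {n} (w : Word n) j → weight (insertAt w j true) ≡ suc (weight w)
weight-insert-true w           zero    = refl
weight-insert-true (true ∷ w)  (suc j) = cong suc (weight-insert-true w j)
weight-insert-true (false ∷ w) (suc j) = weight-insert-true w j

weight-insert-false : ∀ {n} (w : Word n) j → weight (insertAt w j false) ≡ weight w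
weight-insert-false w           zero    = refl
weight-insert-false (true ∷ w)  (suc j) = cong suc (weight-insert-false w j)
weight-insert-false (false ∷ w) (suc j) = weight-insert-false w j

weight≤length : ∀ {n} (u : Word n) → weight u ℕ.≤ n
weight≤length []          = z≤n
weight≤length (true ∷ u)  = s≤s (weight≤length u)
weight≤length (false ∷ u) = ℕₚ.m≤n⇒m≤1+n (weight≤length u)

weight-ones : ∀ n → weight (ones n) ≡ n
weight-ones zero    = refl
weight-ones (suc n) = cong suc (weight-ones n)

-- The sum of φ(weight) over the words with n free columns and a further ones in fixed columns.
T : ℕ → ℕ → (ℕ → ℚ) → ℚ
T n a φ = S n (λ w → φ (a ℕ.+ weight w))

T-cong : ∀ n a {φ χ : ℕ → ℚ} → (∀ j → φ j ≡ χ j) → T n a φ ≡ T n a χ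
T-cong n a h = S-cong n (λ w → h (a ℕ.+ weight w))

T-suc : ∀ n a φ → T (suc n) a φ ≡ T n (suc a) φ + T n a φ
T-suc n a φ = cong (_+ T n a φ) (S-cong n (λ w → cong φ (ℕₚ.+-suc a (weight w))))

-- Double counting: marking a one in a word of length `n+1` can be done at `n+1` positions, and
-- deleting the marked column leaves a word of length `n` accompanied by one more fixed one.
T-weight : ∀ n a φ →
  S (suc n) (λ w → ι (weight w) * φ (a ℕ.+ weight w)) ≡ ι (suc n) * T n (suc a) φ
T-weight zero a φ = trans (cong (ι 1 * φ (a ℕ.+ 1) +_) (ℚₚ.*-zeroˡ (φ (a ℕ.+ 0))))
  (trans (ℚₚ.+-identityʳ (ι 1 * φ (a ℕ.+ 1))) (cong (λ j → ι 1 * φ j) (ℕₚ.+-suc a 0)))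
T-weight (suc n) a φ = begin
  S (suc n) (λ w → ι (suc (weight w)) * φ (a ℕ.+ suc (weight w))) + U a
    ≡⟨ cong (_+ U a) (S-cong (suc n) (λ w → trans
        (cong₂ _*_ (ι-suc (weight w)) (cong φ (ℕₚ.+-suc a (weight w))))
        (solve 2 (λ t p → (con 1ℚ :+ t) :* p := p :+ t :* p) refl (ι (weight w)) (φ (suc a ℕ.+ weight w))))) ⟩
  S (suc n) (λ w → φ (suc a ℕ.+ weight w) + ι (weight w) * φ (suc a ℕ.+ weight w)) + U a
    ≡⟨ cong (_+ U a) (S-+ (suc n) (λ w → φ (suc a ℕ.+ weight w)) (λ w → ι (weight w) * φ (suc a ℕ.+ weight w))) ⟩
  T (suc n) (suc a) φ + U (suc a) + U a
    ≡⟨ cong₂ (λ p q → T (suc n) (suc a) φ + p + q) (T-weight n (suc a) φ) (T-weight n a φ) ⟩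
  T (suc n) (suc a) φ + ι (suc n) * T n (suc (suc a)) φ + ι (suc n) * T n (suc a) φ
    ≡⟨ solve 4 (λ t c p q → t :+ c :* p :+ c :* q := t :+ c :* (p :+ q)) refl
        (T (suc n) (suc a) φ) (ι (suc n)) (T n (suc (suc a)) φ) (T n (suc a) φ) ⟩
  T (suc n) (suc a) φ + ι (suc n) * (T n (suc (suc a)) φ + T n (suc a) φ)
    ≡⟨ cong (λ z → T (suc n) (suc a) φ + ι (suc n) * z) (T-suc n (suc a) φ) ⟨
  T (suc n) (suc a) φ + ι (suc n) * T (suc n) (suc a) φ
    ≡⟨ solve 2 (λ c t → t :+ c :* t := (con 1ℚ :+ c) :* t) refl (ι (suc n)) (T (suc n) (suc a) φ) ⟩
  (1ℚ + ι (suc n)) * T (suc n) (suc a) φ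
    ≡⟨ cong (_* T (suc n) (suc a) φ) (ι-suc (suc n)) ⟨
  ι (suc (suc n)) * T (suc n) (suc a) φ ∎
  where
  open ≡-Reasoning
  U : ℕ → ℚ
  U b = S (suc n) (λ w → ι (weight w) * φ (b ℕ.+ weight w))

-- With `a` ones fixed, `j - a` is the number of ones in free columns, so this factor marks one of
-- them as in `T-weight`.
T-linear : ∀ n a φ → T (suc n) a (λ j → (ι j - ι a) * φ j) ≡ ι (suc n) * T n (suc a) φ
T-linear n a φ = trans (S-cong (suc n) (λ w → cong (_* φ (a ℕ.+ weight w)) (lem (weight w)))) (T-weight n a φ)
  where
  lem : ∀ j → ι (a ℕ.+ j) - ι a ≡ ι j
  lem j = trans (cong (_- ι a) (ι-+ a j)) (solve 2 (λ a j → a :+ j :- a := j) refl (ι a) (ι j))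

-- Each fixed column is traded for a linear factor of the test polynomial g.
T-annihilate : ∀ {ν k} (h : ℕ → ℚ) → (∀ g → Poly k g → T ν 0 (λ j → g (ι j) * h j) ≡ 0ℚ) →
  ∀ m {n e} a g → m ℕ.+ n ≡ ν → m ℕ.+ e ≡ k → a ℕ.≤ m → Poly e g →
  T n a (λ j → g (ι j) * h j) ≡ 0ℚ
T-annihilate h H zero zero g refl refl _ G = H g G
T-annihilate h H (suc m) {n} {e} a g m+n m+e a≤m G = go a a≤m
  where
  m+1+n = trans (ℕₚ.+-suc m n) m+n
  m+1+e = trans (ℕₚ.+-suc m e) m+e
  -- A fixed one becomes a free column at the price of the factor `j - b`: the degree rises by one
  -- while the number of fixed columns drops by one, so their sum stays `k`.
  step : ∀ b → b ℕ.≤ m → T n (suc b) (λ j → g (ι j) * h j) ≡ 0ℚ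
  step b b≤m = *≡0⇒ʳ≡0 (>⇒≢0 (0<ι-suc n)) (trans (sym (T-linear n b (λ j → g (ι j) * h j))) (trans
    (T-cong (suc n) b (λ j → sym (ℚₚ.*-assoc (ι j - ι b) (g (ι j)) (h j))))
    (T-annihilate h H m b (λ y → (y - ι b) * g y) m+1+n m+1+e b≤m (Poly-linear-* e (ι b) G))))
  go : ∀ a → a ℕ.≤ suc m → T n a (λ j → g (ι j) * h j) ≡ 0ℚ
  go (suc b) (s≤s b≤m) = step b b≤m
  -- Without a fixed one there is nothing to trade. Instead a column fixed to zero is freed, and the
  -- words that get a one there contribute nothing by `step 0`.
  go zero    _ = begin
    T n 0 φ              ≡⟨ ℚₚ.+-identityˡ (T n 0 φ) ⟨
    0ℚ + T n 0 φ         ≡⟨ cong (_+ T n 0 φ) (step 0 z≤n) ⟨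
    T n 1 φ + T n 0 φ    ≡⟨ T-suc n 0 φ ⟨
    T (suc n) 0 φ        ≡⟨ T-annihilate h H m 0 g m+1+n m+1+e z≤n (Poly-suc e G) ⟩
    0ℚ                   ∎
    where
    open ≡-Reasoning
    φ : ℕ → ℚ
    φ j = g (ι j) * h j

-- Indicators

indᵇ : Bool → Bool → ℚ
indᵇ true  true  = 1ℚ
indᵇ true  false = 0ℚ
indᵇ false true  = 0ℚ
indᵇ false false = 1ℚ

ind : ∀ {n} → Word n → Word n → ℚ
ind []      []      = 1ℚ
ind (b ∷ v) (c ∷ w) = indᵇ b c * ind v w

ind-refl : ∀ {n} (v : Word n) → ind v v ≡ 1ℚ
ind-refl []          = refl
ind-refl (true ∷ v)  = trans (ℚₚ.*-identityˡ (ind v v)) (ind-refl v)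
ind-refl (false ∷ v) = trans (ℚₚ.*-identityˡ (ind v v)) (ind-refl v)

ind-≢ : ∀ {n} (v w : Word n) → v ≢ w → ind v w ≡ 0ℚ
ind-≢ []          []          v≢w = contradiction refl v≢w
ind-≢ (true ∷ v)  (false ∷ w) v≢w = ℚₚ.*-zeroˡ (ind v w)
ind-≢ (false ∷ v) (true ∷ w)  v≢w = ℚₚ.*-zeroˡ (ind v w)
ind-≢ (true ∷ v)  (true ∷ w)  v≢w = trans (ℚₚ.*-identityˡ (ind v w)) (ind-≢ v w (λ eq → v≢w (cong (true ∷_) eq)))
ind-≢ (false ∷ v) (false ∷ w) v≢w = trans (ℚₚ.*-identityˡ (ind v w)) (ind-≢ v w (λ eq → v≢w (cong (false ∷_) eq)))

_≟ʷ_ : ∀ {n} (v w : Word n) → Dec (v ≡ w)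
_≟ʷ_ = Vecₚ.≡-dec Boolₚ._≟_

0≤ind : ∀ {n} (v w : Word n) → 0ℚ ≤ℚ ind v w
0≤ind v w with v ≟ʷ w
... | yes refl = subst (0ℚ ≤ℚ_) (sym (ind-refl v)) (ℚₚ.nonNegative⁻¹ 1ℚ)
... | no  v≢w  = ℚₚ.≤-reflexive (sym (ind-≢ v w v≢w))

S-ind : ∀ n (φ : Word n → ℚ) w → S n (λ v → φ v * ind v w) ≡ φ w
S-ind zero    φ []          = ℚₚ.*-identityʳ (φ [])
S-ind (suc n) φ (true ∷ w)  = trans (cong₂ _+_
  (trans (S-cong n (λ v → cong (φ (true ∷ v) *_) (ℚₚ.*-identityˡ (ind v w)))) (S-ind n (λ v → φ (true ∷ v)) w))
  (S-0 n (λ v → trans (cong (φ (false ∷ v) *_) (ℚₚ.*-zeroˡ (ind v w))) (ℚₚ.*-zeroʳ (φ (false ∷ v))))))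
  (ℚₚ.+-identityʳ (φ (true ∷ w)))
S-ind (suc n) φ (false ∷ w) = trans (cong₂ _+_
  (S-0 n (λ v → trans (cong (φ (true ∷ v) *_) (ℚₚ.*-zeroˡ (ind v w))) (ℚₚ.*-zeroʳ (φ (true ∷ v)))))
  (trans (S-cong n (λ v → cong (φ (false ∷ v) *_) (ℚₚ.*-identityˡ (ind v w)))) (S-ind n (λ v → φ (false ∷ v)) w)))
  (ℚₚ.+-identityˡ (φ (false ∷ w)))

pick : ∀ {m n} → (Fin m → Fin n) → Word n → Word m
pick c w = tabulate (λ j → lookup w (c j))

-- The column `c zero` is deleted and the other chosen columns are renumbered by `punchOut`. The
-- indicator keeps one of the two values in the deleted column, and a one there shifts the argument
-- of `φ`.
S-pick : ∀ m n (c : Fin m → Fin (m ℕ.+ n)) → Injective _≡_ _≡_ c → ∀ u (φ : ℕ → ℚ) →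
  S (m ℕ.+ n) (λ w → φ (weight w) * ind (pick c w) u) ≡ T n (weight u) φ
S-pick zero    n c c-inj []      φ = S-cong n (λ w → ℚₚ.*-identityʳ (φ (weight w)))
S-pick (suc m) n c c-inj (b ∷ u) φ = trans (S-insert (m ℕ.+ n) (c zero) ψ) (trans
  (cong₂ _+_ (half true suc (λ w → weight-insert-true w (c zero))) (half false (λ j → j) (λ w → weight-insert-false w (c zero))))
  (halves b))
  where
  c0≢ : ∀ t → c zero ≢ c (suc t)
  c0≢ t eq with () ← c-inj eq
  c′ : Fin m → Fin (m ℕ.+ n)
  c′ t = Fin.punchOut (c0≢ t)
  c′-inj : Injective _≡_ _≡_ c′
  c′-inj eq = Finₚ.suc-injective (c-inj (Finₚ.punchOut-injective (c0≢ _) (c0≢ _) eq))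
  ψ : Word (suc (m ℕ.+ n)) → ℚ
  ψ w = φ (weight w) * ind (pick c w) (b ∷ u)
  pick-insert : ∀ w b′ → pick c (insertAt w (c zero) b′) ≡ b′ ∷ pick c′ w
  pick-insert w b′ = cong₂ _∷_ (Vecₚ.insertAt-lookup w (c zero) b′) (Vecₚ.tabulate-cong (λ t →
    trans (cong (lookup (insertAt w (c zero) b′)) (sym (Finₚ.punchIn-punchOut (c0≢ t))))
          (Vecₚ.insertAt-punchIn w (c zero) b′ (c′ t))))
  1* : ∀ p q → p * (1ℚ * q) ≡ p * q
  1* = solve 2 (λ p q → p :* (con 1ℚ :* q) := p :* q) refl
  0* : ∀ p q → p * (0ℚ * q) ≡ 0ℚ
  0* = solve 2 (λ p q → p :* (con 0ℚ :* q) := con 0ℚ) refl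
  half : ∀ b′ (f : ℕ → ℕ) → (∀ w → weight (insertAt w (c zero) b′) ≡ f (weight w)) →
    S (m ℕ.+ n) (λ w → ψ (insertAt w (c zero) b′)) ≡ S (m ℕ.+ n) (λ w → φ (f (weight w)) * (indᵇ b′ b * ind (pick c′ w) u))
  half b′ f weight-f = S-cong (m ℕ.+ n) (λ w → cong₂ (λ p q → φ p * ind q (b ∷ u)) (weight-f w) (pick-insert w b′))
  halves : ∀ b → S (m ℕ.+ n) (λ w → φ (suc (weight w)) * (indᵇ true b * ind (pick c′ w) u))
    + S (m ℕ.+ n) (λ w → φ (weight w) * (indᵇ false b * ind (pick c′ w) u)) ≡ T n (weight (b ∷ u)) φ
  halves true = trans (cong₂ _+_
    (trans (S-cong (m ℕ.+ n) (λ w → 1* (φ (suc (weight w))) (ind (pick c′ w) u))) (S-pick m n c′ c′-inj u (λ j → φ (suc j))))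
    (S-0 (m ℕ.+ n) (λ w → 0* (φ (weight w)) (ind (pick c′ w) u)))) (ℚₚ.+-identityʳ (T n (suc (weight u)) φ))
  halves false = trans (cong₂ _+_
    (S-0 (m ℕ.+ n) (λ w → 0* (φ (suc (weight w))) (ind (pick c′ w) u)))
    (trans (S-cong (m ℕ.+ n) (λ w → 1* (φ (weight w)) (ind (pick c′ w) u))) (S-pick m n c′ c′-inj u φ))) (ℚₚ.+-identityˡ (T n (weight u) φ))

S-pick′ : ∀ {m n μ} → m ℕ.+ n ≡ μ → (c : Fin m → Fin μ) → Injective _≡_ _≡_ c → ∀ u (φ : ℕ → ℚ) →
  S μ (λ w → φ (weight w) * ind (pick c w) u) ≡ T n (weight u) φ
S-pick′ {m} {n} refl = S-pick m n

-- Words by weight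

δ : ℕ → ℕ → ℚ
δ zero    zero    = 1ℚ
δ zero    (suc i) = 0ℚ
δ (suc j) zero    = 0ℚ
δ (suc j) (suc i) = δ j i

δ-refl : ∀ j → δ j j ≡ 1ℚ
δ-refl zero    = refl
δ-refl (suc j) = δ-refl j

δ-≢ : ∀ j i → j ≢ i → δ j i ≡ 0ℚ
δ-≢ zero    zero    h = contradiction refl h
δ-≢ zero    (suc i) h = refl
δ-≢ (suc j) zero    h = refl
δ-≢ (suc j) (suc i) h = δ-≢ j i (λ eq → h (cong suc eq))

S-δ : ∀ n i → S n (λ w → δ (weight w) i) ≡ ι (n C i)
S-δ zero    zero    = refl
S-δ zero    (suc i) = refl
S-δ (suc n) zero    = trans (cong₂ _+_ (S-0 n (λ w → refl)) (S-δ n zero)) (ℚₚ.+-identityˡ (ι (n C 0)))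
S-δ (suc n) (suc i) = trans (cong₂ _+_ (S-δ n i) (S-δ n (suc i)))
  (trans (sym (ι-+ (n C i) (n C suc i))) (cong ι (nCk+nC[k+1]≡[n+1]C[k+1] n i)))

S-by-weight : ∀ n {m} (i : Fin m → ℕ) → (∀ r s → r ≢ s → i r ≢ i s) →
  (H : ℕ → ℚ) → (∀ j → (∀ r → j ≢ i r) → H j ≡ 0ℚ) →
  S n (λ w → H (weight w)) ≡ Σℚ m (λ r → ι (n C i r) * H (i r))
S-by-weight n {m} i i-inj H supp = begin
  S n (λ w → H (weight w))
    ≡⟨ S-cong n (λ w → expand (weight w)) ⟩
  S n (λ w → Σℚ m (λ r → H (i r) * δ (weight w) (i r)))
    ≡⟨ S-Σ n m (λ r w → H (i r) * δ (weight w) (i r)) ⟩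
  Σℚ m (λ r → S n (λ w → H (i r) * δ (weight w) (i r)))
    ≡⟨ Σ-cong m (λ r → trans (S-*ˡ n (H (i r)) (λ w → δ (weight w) (i r)))
         (trans (cong (H (i r) *_) (S-δ n (i r))) (ℚₚ.*-comm (H (i r)) (ι (n C i r))))) ⟩
  Σℚ m (λ r → ι (n C i r) * H (i r)) ∎
  where
  open ≡-Reasoning
  vanish : ∀ j r → j ≢ i r → H (i r) * δ j (i r) ≡ 0ℚ
  vanish j r j≢ = trans (cong (H (i r) *_) (δ-≢ j (i r) j≢)) (ℚₚ.*-zeroʳ (H (i r)))
  expand : ∀ j → H j ≡ Σℚ m (λ r → H (i r) * δ j (i r))
  expand j with Finₚ.any? (λ r → j ℕ.≟ i r)
  ... | no  ∄r = trans (supp j (λ r eq → ∄r (r , eq))) (sym (Σ-0 m (λ r → vanish j r (λ eq → ∄r (r , eq)))))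
  ... | yes (t , refl) = sym (trans
    (Σ-single m {λ r → H (i r) * δ (i t) (i r)} t (λ r r≢t → vanish (i t) r (i-inj t r (λ eq → r≢t (sym eq)))))
    (trans (cong (H (i t) *_) (δ-refl (i t))) (ℚₚ.*-identityʳ (H (i t)))))

-- Sums over the rows of an array

sumL : ∀ {A : Set} → (A → ℚ) → List A → ℚ
sumL F []       = 0ℚ
sumL F (x ∷ xs) = F x + sumL F xs

sumL-cong : ∀ {A : Set} {F G : A → ℚ} → (∀ x → F x ≡ G x) → ∀ xs → sumL F xs ≡ sumL G xs
sumL-cong h []       = refl
sumL-cong h (x ∷ xs) = cong₂ _+_ (h x) (sumL-cong h xs)

sumL-++ : ∀ {A : Set} (F : A → ℚ) xs ys → sumL F (xs ++ ys) ≡ sumL F xs + sumL F ys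
sumL-++ F []       ys = sym (ℚₚ.+-identityˡ (sumL F ys))
sumL-++ F (x ∷ xs) ys = trans (cong (F x +_) (sumL-++ F xs ys)) (sym (ℚₚ.+-assoc (F x) (sumL F xs) (sumL F ys)))

sumL-map : ∀ {A B : Set} (F : B → ℚ) (f : A → B) xs → sumL F (map f xs) ≡ sumL (λ x → F (f x)) xs
sumL-map F f []       = refl
sumL-map F f (x ∷ xs) = cong (F (f x) +_) (sumL-map F f xs)

sumL-replicate : ∀ {A : Set} (F : A → ℚ) n x → sumL F (replicate n x) ≡ ι n * F x
sumL-replicate F zero    x = sym (ℚₚ.*-zeroˡ (F x))
sumL-replicate F (suc n) x = trans (cong (F x +_) (sumL-replicate F n x)) (trans
  (solve 2 (λ f t → f :+ t :* f := (con 1ℚ :+ t) :* f) refl (F x) (ι n)) (cong (_* F x) (sym (ι-suc n))))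

sumL-1 : ∀ {A : Set} (xs : List A) → sumL (λ _ → 1ℚ) xs ≡ ι (length xs)
sumL-1 []       = refl
sumL-1 (x ∷ xs) = trans (cong (1ℚ +_) (sumL-1 xs)) (sym (ι-suc (length xs)))

sumL-↭ : ∀ {A : Set} (F : A → ℚ) {xs ys} → xs ↭ ys → sumL F xs ≡ sumL F ys
sumL-↭ F ↭.refl = refl
sumL-↭ F (↭.prep x p) = cong (F x +_) (sumL-↭ F p)
sumL-↭ F {ys = _ ∷ _ ∷ ys} (↭.swap x y p) = trans (cong (λ z → F x + (F y + z)) (sumL-↭ F p))
  (solve 3 (λ a b c → a :+ (b :+ c) := b :+ (a :+ c)) refl (F x) (F y) (sumL F ys))
sumL-↭ F (↭.trans p q) = trans (sumL-↭ F p) (sumL-↭ F q)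

count : ∀ {n} → Array n → Word n → ℚ
count A w = sumL (λ v → ind v w) A

occ-count : ∀ {n} (A : Array n) w → ι (occ A w) ≡ count A w
occ-count []      w = refl
occ-count (v ∷ A) w with v ≟ʷ w
... | yes refl = trans (ι-suc (occ A w)) (cong₂ _+_ (sym (ind-refl v)) (occ-count A w))
... | no  v≢w  = trans (occ-count A w) (trans (sym (ℚₚ.+-identityˡ (count A w))) (cong (_+ count A w) (sym (ind-≢ v w v≢w))))

0≤count : ∀ {n} (A : Array n) w → 0ℚ ≤ℚ count A w
0≤count []      w = ℚₚ.≤-refl
0≤count (v ∷ A) w = +-nonNeg (0≤ind v w) (0≤count A w)

0<count-head : ∀ {n} (v : Word n) A → 0ℚ <ℚ count (v ∷ A) v
0<count-head v A = ℚₚ.+-mono-<-≤ (subst (0ℚ <ℚ_) (sym (ind-refl v)) (ℚₚ.positive⁻¹ 1ℚ)) (0≤count A v)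

∈⇒0<count : ∀ {n} {A : Array n} {w} → w ∈ A → 0ℚ <ℚ count A w
∈⇒0<count {A = v ∷ A} (here refl) = 0<count-head v A
∈⇒0<count {A = v ∷ A} {w} (there w∈A) = ℚₚ.+-mono-≤-< (0≤ind v w) (∈⇒0<count w∈A)

count≢0⇒∈ : ∀ {n} (A : Array n) {w} → count A w ≢ 0ℚ → w ∈ A
count≢0⇒∈ []      c≢0 = contradiction refl c≢0
count≢0⇒∈ (v ∷ A) {w} c≢0 with v ≟ʷ w
... | yes refl = here refl
... | no  v≢w  = there (count≢0⇒∈ A (λ c≡0 → c≢0 (cong₂ _+_ (ind-≢ v w v≢w) c≡0)))

-- The head of `A` has positive count in `B`, hence occurs there; it is moved to the front and its
-- indicator cancelled from both counts.
counts⇒↭ : ∀ {n} (A B : Array n) → (∀ w → count A w ≡ count B w) → A ↭ B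
counts⇒↭ []      []      h = ↭.refl
counts⇒↭ []      (b ∷ B) h = contradiction (sym (h b)) (>⇒≢0 (0<count-head b B))
counts⇒↭ (a ∷ A) B       h with ∈-∃++ (count≢0⇒∈ B (λ c≡0 → >⇒≢0 (0<count-head a A) (trans (h a) c≡0)))
... | ys , zs , refl = ↭-trans (prep a (counts⇒↭ A (ys ++ zs) rest)) (↭-sym (↭ₚ.shift a ys zs))
  where
  cancel : ∀ p {q r} → p + q ≡ p + r → q ≡ r
  cancel p {q} {r} eq = trans (lem p q) (trans (cong (_- p) eq) (sym (lem p r)))
    where
    lem : ∀ p q → q ≡ p + q - p
    lem = solve 2 (λ p q → q := p :+ q :- p) refl
  rest : ∀ w → count A w ≡ count (ys ++ zs) w
  rest w = cancel (ind a w) (trans (h w) (sumL-↭ (λ v → ind v w) (↭ₚ.shift a ys zs)))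

-- The recursion is that of `S`, so that sums over rows become sums over all words.
build : ∀ n → (Word n → ℕ) → Array n
build zero    f = replicate (f []) []
build (suc n) f = map (true ∷_) (build n (λ w → f (true ∷ w))) ++ map (false ∷_) (build n (λ w → f (false ∷ w)))

sumL-build : ∀ n f (F : Word n → ℚ) → sumL F (build n f) ≡ S n (λ w → ι (f w) * F w)
sumL-build zero    f F = sumL-replicate F (f []) []
sumL-build (suc n) f F = trans
  (sumL-++ F (map (true ∷_) (build n (λ w → f (true ∷ w)))) (map (false ∷_) (build n (λ w → f (false ∷ w)))))
  (cong₂ _+_ (trans (sumL-map F (true ∷_) (build n (λ w → f (true ∷ w)))) (sumL-build n (λ w → f (true ∷ w)) (λ w → F (true ∷ w))))
             (trans (sumL-map F (false ∷_) (build n (λ w → f (false ∷ w)))) (sumL-build n (λ w → f (false ∷ w)) (λ w → F (false ∷ w)))))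

count-build : ∀ n f w → count (build n f) w ≡ ι (f w)
count-build n f w = trans (sumL-build n f (λ v → ind v w)) (S-ind n (λ v → ι (f v)) w)

occ-build : ∀ n f w → occ (build n f) w ≡ f w
occ-build n f w = ι-injective (trans (occ-count (build n f) w) (count-build n f w))

-- The regular arrays of an admissible sequence

0<C : ∀ n i → i ℕ.≤ n → 0 ℕ.< n C i
0<C n       zero    _         = ℕₚ.≤-reflexive (sym (trans (nCk≡nC[n∸k] {0} {n} z≤n) (nCn≡1 n)))
0<C (suc n) (suc i) (s≤s i≤n) = subst (0 ℕ.<_) (nCk+nC[k+1]≡[n+1]C[k+1] n i) (ℕₚ.<-≤-trans (0<C n i i≤n) (ℕₚ.m≤m+n (n C i) (n C suc i)))

does-inject₁ : ∀ {n} (s r : Fin n) → does (inject₁ s Fin.≟ inject₁ r) ≡ does (s Fin.≟ r)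
does-inject₁ zero    zero    = refl
does-inject₁ zero    (suc r) = refl
does-inject₁ (suc s) zero    = refl
does-inject₁ (suc s) (suc r) = does-inject₁ s r

alt-inject₁ : ∀ {n} (r : Fin n) → alt (inject₁ r) ≡ - alt r
alt-inject₁ {suc n} zero    = refl
alt-inject₁ {suc n} (suc r) = alt-inject₁ r

alt-fromℕ : ∀ n → alt (fromℕ n) ≡ 1ℚ
alt-fromℕ zero    = refl
alt-fromℕ (suc n) = alt-fromℕ n

mod2 : ∀ a → (a % 2 ≡ 0 × suc a % 2 ≡ 1) ⊎ (a % 2 ≡ 1 × suc a % 2 ≡ 0)
mod2 zero          = inj₁ (refl , refl)
mod2 (suc zero)    = inj₂ (refl , refl)
mod2 (suc (suc a)) = mod2 a

mod2-suc : ∀ a b → suc a % 2 ≡ suc b % 2 → a % 2 ≡ b % 2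
mod2-suc a b eq with mod2 a | mod2 b
... | inj₁ (p , _) | inj₁ (q , _) = trans p (sym q)
... | inj₂ (p , _) | inj₂ (q , _) = trans p (sym q)
... | inj₁ (_ , p) | inj₂ (_ , q) with () ← trans (sym p) (trans eq q)
... | inj₂ (_ , p) | inj₁ (_ , q) with () ← trans (sym p) (trans eq q)

mod2-suc⁻¹ : ∀ a b → a % 2 ≡ b % 2 → suc a % 2 ≡ suc b % 2
mod2-suc⁻¹ a b = mod2-suc (suc a) (suc b)

-- Here `alt` runs over all `k+2` indices, one more than the interpolation nodes, so its sign is +1
-- at `ν` and -1 at `d`: plus for `N`, minus for `D`.
alt-parity : ∀ k (r : Fin (suc (suc k))) →
  (toℕ r % 2 ≡ k % 2 → alt r ≡ - 1ℚ) × (toℕ r % 2 ≢ k % 2 → alt r ≡ 1ℚ)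
alt-parity zero    zero       = (λ _ → refl) , (λ h → contradiction refl h)
alt-parity zero    (suc zero) = (λ ()) , (λ _ → refl)
alt-parity (suc zero)    zero = (λ ()) , (λ _ → refl)
alt-parity (suc (suc k)) zero with alt-parity k zero
... | e , o = (λ h → trans (neg² (±1 (suc k))) (e h)) , (λ h → trans (neg² (±1 (suc k))) (o h))
  where
  neg² : ∀ p → - (- p) ≡ p
  neg² = solve 1 (λ p → :- (:- p) := p) refl
alt-parity (suc k) (suc r) with alt-parity k r
... | e , o = (λ h → e (mod2-suc (toℕ r) k h)) , (λ h → o (λ h′ → h (mod2-suc⁻¹ (toℕ r) k h′)))

last-parity : ∀ k → toℕ (fromℕ (suc k)) % 2 ≢ k % 2
last-parity k h with mod2 k
... | inj₁ (p , q) with () ← trans (sym q) (trans (cong (_% 2) (sym (Finₚ.toℕ-fromℕ (suc k)))) (trans h p))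
... | inj₂ (p , q) with () ← trans (sym q) (trans (cong (_% 2) (sym (Finₚ.toℕ-fromℕ (suc k)))) (trans h p))

fromℕ-inject₁-elim : ∀ {n} (Q : Fin (suc n) → Set) → Q (fromℕ n) → (∀ r → Q (inject₁ r)) → ∀ r → Q r
fromℕ-inject₁-elim Q top below r with view r
... | ‵fromℕ     = top
... | ‵inject₁ s = below s

module _ {m} (i M : Fin m → ℕ) (on : Fin m → Bool) where

  profile : ℕ → ℕ
  profile j with Finₚ.any? (λ r → j ℕ.≟ i r)
  ... | yes (r , _) = if on r then M r else 0
  ... | no  _       = 0

  profile-node : (∀ r s → r ≢ s → i r ≢ i s) → ∀ r → profile (i r) ≡ (if on r then M r else 0)
  profile-node i-inj r with Finₚ.any? (λ s → i r ℕ.≟ i s)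
  ... | no  ∄s = contradiction (r , refl) ∄s
  ... | yes (s , eq) with s Fin.≟ r
  ...   | yes refl = refl
  ...   | no  s≢r  = contradiction (sym eq) (i-inj s r s≢r)

  profile-on : (∀ r s → r ≢ s → i r ≢ i s) → ∀ r → on r ≡ true → profile (i r) ≡ M r
  profile-on i-inj r h = trans (profile-node i-inj r) (cong (λ b → if b then M r else 0) h)

  profile-out : (∀ r s → r ≢ s → i r ≢ i s) → ∀ r → on r ≡ false → profile (i r) ≡ 0
  profile-out i-inj r h = trans (profile-node i-inj r) (cong (λ b → if b then M r else 0) h)

  profile-off : ∀ j → (∀ r → j ≢ i r) → profile j ≡ 0
  profile-off j h with Finₚ.any? (λ r → j ℕ.≟ i r)
  ... | yes (r , eq) = contradiction eq (h r)
  ... | no  _        = refl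

  profile-support : ∀ j → profile j ≢ 0 → ∃[ r ] (j ≡ i r × on r ≡ true)
  profile-support j p≢0 with Finₚ.any? (λ r → j ℕ.≟ i r)
  ... | no  _ = contradiction refl p≢0
  ... | yes (r , eq) with on r in on-r
  ...   | true  = r , eq , on-r
  ...   | false = contradiction refl p≢0

module Nodes {k d ν} (i : Seq k) (adm : Admissible ν d k i) where

  i-inc : Increasing i
  i-inc = proj₁ (proj₂ adm)

  x : Fin (suc k) → ℕ
  x r = i (inject₁ r)

  x-inc : Increasing x
  x-inc r s r<s = i-inc (inject₁ r) (inject₁ s) (subst₂ ℕ._<_ (sym (Finₚ.toℕ-inject₁ r)) (sym (Finₚ.toℕ-inject₁ s)) r<s)

  x-last : x (fromℕ k) ≡ d
  x-last = proj₁ (proj₂ (proj₂ adm))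

  i-last : i (fromℕ (suc k)) ≡ ν
  i-last = proj₂ (proj₂ (proj₂ adm))

  inject₁<fromℕ : ∀ {n} (r : Fin n) → inject₁ r Fin.< fromℕ n
  inject₁<fromℕ {n} r = subst₂ ℕ._<_ (sym (Finₚ.toℕ-inject₁ r)) (sym (Finₚ.toℕ-fromℕ n)) (Finₚ.toℕ<n r)

  x<ν : ∀ r → x r ℕ.< ν
  x<ν r = subst (x r ℕ.<_) i-last (i-inc (inject₁ r) (fromℕ (suc k)) (inject₁<fromℕ r))

  x≤d : ∀ r → x r ℕ.≤ d
  x≤d r with view r
  ... | ‵fromℕ     = ℕₚ.≤-reflexive x-last
  ... | ‵inject₁ s = ℕₚ.<⇒≤ (subst (x (inject₁ s) ℕ.<_) x-last (x-inc (inject₁ s) (fromℕ k) (inject₁<fromℕ s)))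

  i≤ν : ∀ r → i r ℕ.≤ ν
  i≤ν r with view r
  ... | ‵fromℕ     = ℕₚ.≤-reflexive i-last
  ... | ‵inject₁ s = ℕₚ.<⇒≤ (x<ν s)

  i-distinct : ∀ r s → r ≢ s → i r ≢ i s
  i-distinct = increasing⇒distinct i-inc

  open Lagrange x x-inc public
  open Beyond ν x<ν public

  P-nodes : ∀ r → P ν k i (inject₁ r) ≡ absBasis r ν
  P-nodes r = Π-cong (suc k) (λ s → cong (λ b → if b then 1ℚ else ((ν ∸ x s) /ℕ ∣ x r - x s ∣)) (does-inject₁ s r))

  -- As `i` ends at `ν`, numerator and denominator of every factor coincide.
  P-last : P ν k i (fromℕ (suc k)) ≡ 1ℚ
  P-last = Π-1 (suc k) factor
    where
    factor : ∀ s → (if does (inject₁ s Fin.≟ fromℕ (suc k)) then 1ℚ else ((ν ∸ x s) /ℕ ∣ i (fromℕ (suc k)) - x s ∣)) ≡ 1ℚ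
    factor s with inject₁ s Fin.≟ fromℕ (suc k)
    ... | yes _ = refl
    ... | no  _ = trans (cong (λ z → (ν ∸ x s) /ℕ ∣ z - x s ∣) i-last) (trans
      (cong ((ν ∸ x s) /ℕ_) (ℕₚ.m≤n⇒∣n-m∣≡n∸m (ℕₚ.<⇒≤ (x<ν s)))) (/ℕ-refl (ℕₚ.m<n⇒0<n∸m (x<ν s))))

  C≢0 : ∀ r → ι (ν C i r) ≢ 0ℚ
  C≢0 r = >⇒≢0 (0<ι (0<C ν (i r) (i≤ν r)))

  0<P : ∀ r → 0ℚ <ℚ P ν k i (inject₁ r)
  0<P r = subst (0ℚ <ℚ_) (sym (P-nodes r)) (absBasis-pos r)

  ΣP : ℚ
  ΣP = Σℚ (suc k) (λ r → P ν k i (inject₁ r))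

  0<ΣP : 0ℚ <ℚ ΣP
  0<ΣP = Σ-pos (suc k) (λ r → ℚₚ.<⇒≤ (0<P r)) zero (0<P zero)

  0<1+ΣP : 0ℚ <ℚ 1ℚ + ΣP
  0<1+ΣP = ℚₚ.+-mono-≤-< (ℚₚ.nonNegative⁻¹ 1ℚ) 0<ΣP

  value-* : value ν k i * (1ℚ + ΣP) ≡ ι 2
  value-* = /ℚ-* (ι 2) (>⇒≢0 0<1+ΣP)

module Construction {k d ν} (k≤d : k ℕ.≤ d) (d<ν : d ℕ.< ν) (i : Seq k) (adm : Admissible ν d k i)
  (Rs : ℕ) (1≤Rs : 1 ℕ.≤ Rs)
  (integral : ∀ (r : Fin (suc k)) → ∃[ n ] (mult ν k i Rs (inject₁ r) ≡ ℕtoℚ n)) where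

  open Nodes i adm

  mult-* : ∀ r → ι (ν C i r) * mult ν k i Rs r ≡ ι Rs * P ν k i r
  mult-* r = trans (ℚₚ.*-comm (ι (ν C i r)) (mult ν k i Rs r)) (/ℚ-* (ι Rs * P ν k i r) (C≢0 r))

  -- Integrality is assumed only for the first `k+1` indices. At weight `ν` the product and the
  -- binomial coefficient are both 1, which makes `Rs` the number of all-ones rows.
  mult-last : mult ν k i Rs (fromℕ (suc k)) ≡ ι Rs
  mult-last = *-cancelʳ (C≢0 (fromℕ (suc k))) (trans (/ℚ-* (ι Rs * P ν k i (fromℕ (suc k))) (C≢0 (fromℕ (suc k))))
    (cong (ι Rs *_) (trans P-last (sym (cong ι (trans (cong (ν C_) i-last) (nCn≡1 ν)))))))

  multiplicity : ∀ r → ∃[ n ] (mult ν k i Rs r ≡ ι n)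
  multiplicity = fromℕ-inject₁-elim (λ r → ∃[ n ] (mult ν k i Rs r ≡ ι n)) (Rs , mult-last) integral

  M : Fin (suc (suc k)) → ℕ
  M r = proj₁ (multiplicity r)

  C*M : ∀ r → ι (ν C i r) * ι (M r) ≡ ι Rs * P ν k i r
  C*M r = trans (cong (ι (ν C i r) *_) (sym (proj₂ (multiplicity r)))) (mult-* r)

  inD inN : Fin (suc (suc k)) → Bool
  inD r = does (toℕ r % 2 ℕ.≟ k % 2)
  inN r = not (inD r)

  inD-true : ∀ r → toℕ r % 2 ≡ k % 2 → inD r ≡ true
  inD-true r = dec-true (toℕ r % 2 ℕ.≟ k % 2)

  inD-false : ∀ r → toℕ r % 2 ≢ k % 2 → inD r ≡ false
  inD-false r = dec-false (toℕ r % 2 ℕ.≟ k % 2)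

  fN fD : ℕ → ℕ
  fN = profile i M inN
  fD = profile i M inD

  N D : Array ν
  N = build ν (λ w → fN (weight w))
  D = build ν (λ w → fD (weight w))

  inD-node : ∀ r → toℕ r % 2 ≡ k % 2 → (fD (i r) ≡ M r) × (fN (i r) ≡ 0)
  inD-node r h = profile-on i M inD i-distinct r (inD-true r h) , profile-out i M inN i-distinct r (cong not (inD-true r h))

  inN-node : ∀ r → toℕ r % 2 ≢ k % 2 → (fN (i r) ≡ M r) × (fD (i r) ≡ 0)
  inN-node r h = profile-on i M inN i-distinct r (cong not (inD-false r h)) , profile-out i M inD i-distinct r (inD-false r h)

  sig : ℕ → ℚ
  sig j = ι (fN j) - ι (fD j)

  sig-node : ∀ r → sig (i r) ≡ alt r * ι (M r)
  sig-node r = by-parity (toℕ r % 2 ℕ.≟ k % 2)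
    where
    by-parity : Dec (toℕ r % 2 ≡ k % 2) → sig (i r) ≡ alt r * ι (M r)
    by-parity (yes h) = trans (cong₂ (λ p q → ι p - ι q) (proj₂ (inD-node r h)) (proj₁ (inD-node r h)))
      (trans (solve 1 (λ m → con 0ℚ :- m := (:- con 1ℚ) :* m) refl (ι (M r))) (cong (_* ι (M r)) (sym (proj₁ (alt-parity k r) h))))
    by-parity (no h) = trans (cong₂ (λ p q → ι p - ι q) (proj₁ (inN-node r h)) (proj₂ (inN-node r h)))
      (trans (solve 1 (λ m → m :- con 0ℚ := con 1ℚ :* m) refl (ι (M r))) (cong (_* ι (M r)) (sym (proj₂ (alt-parity k r) h))))

  sig-off : ∀ j → (∀ r → j ≢ i r) → sig j ≡ 0ℚ
  sig-off j h = cong₂ (λ p q → ι p - ι q) (profile-off i M inN j h) (profile-off i M inD j h)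

  -- There are `ν C i r` words of each node weight, which cancels the denominator of `mult` and
  -- leaves `Rs` times the alternating sum of `g(i_r) P_r`. Its last term is `g(ν)`; the others sum
  -- to `- g(ν)` by interpolation, since `alt` changes sign under `inject₁`.
  sig-orthogonal : ∀ g → Poly k g → T ν 0 (λ j → g (ι j) * sig j) ≡ 0ℚ
  sig-orthogonal g G = begin
    S ν (λ w → g (ι (weight w)) * sig (weight w))
      ≡⟨ S-by-weight ν i i-distinct (λ j → g (ι j) * sig j)
           (λ j h → trans (cong (g (ι j) *_) (sig-off j h)) (ℚₚ.*-zeroʳ (g (ι j)))) ⟩
    Σℚ (suc (suc k)) (λ r → ι (ν C i r) * (g (ι (i r)) * sig (i r)))
      ≡⟨ Σ-cong (suc (suc k)) term ⟩
    Σℚ (suc (suc k)) (λ r → ι Rs * (alt r * g (ι (i r)) * P ν k i r))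
      ≡⟨ Σ-*ˡ (suc (suc k)) (ι Rs) (λ r → alt r * g (ι (i r)) * P ν k i r) ⟩
    ι Rs * Σℚ (suc (suc k)) (λ r → alt r * g (ι (i r)) * P ν k i r)
      ≡⟨ cong (ι Rs *_) (Σ-last (suc k) (λ r → alt r * g (ι (i r)) * P ν k i r)) ⟩
    ι Rs * (Σℚ (suc k) (λ r → alt (inject₁ r) * g (ι (x r)) * P ν k i (inject₁ r)) + last)
      ≡⟨ cong₂ (λ p q → ι Rs * (p + q)) inner last≡ ⟩
    ι Rs * (- 1ℚ * g (ι ν) + g (ι ν))
      ≡⟨ solve 2 (λ R p → R :* ((:- con 1ℚ) :* p :+ p) := con 0ℚ) refl (ι Rs) (g (ι ν)) ⟩
    0ℚ ∎
    where
    open ≡-Reasoning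
    last : ℚ
    last = alt (fromℕ (suc k)) * g (ι (i (fromℕ (suc k)))) * P ν k i (fromℕ (suc k))
    last≡ : last ≡ g (ι ν)
    last≡ = trans (cong₂ _*_ (cong₂ _*_ (alt-fromℕ (suc k)) (cong (λ j → g (ι j)) i-last)) P-last)
      (solve 1 (λ p → con 1ℚ :* p :* con 1ℚ := p) refl (g (ι ν)))
    term : ∀ r → ι (ν C i r) * (g (ι (i r)) * sig (i r)) ≡ ι Rs * (alt r * g (ι (i r)) * P ν k i r)
    term r = begin
      ι (ν C i r) * (g (ι (i r)) * sig (i r))
        ≡⟨ cong (λ z → ι (ν C i r) * (g (ι (i r)) * z)) (sig-node r) ⟩
      ι (ν C i r) * (g (ι (i r)) * (alt r * ι (M r)))
        ≡⟨ solve 4 (λ c g a m → c :* (g :* (a :* m)) := a :* g :* (c :* m)) refl (ι (ν C i r)) (g (ι (i r))) (alt r) (ι (M r)) ⟩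
      alt r * g (ι (i r)) * (ι (ν C i r) * ι (M r))
        ≡⟨ cong (alt r * g (ι (i r)) *_) (C*M r) ⟩
      alt r * g (ι (i r)) * (ι Rs * P ν k i r)
        ≡⟨ solve 3 (λ a R p → a :* (R :* p) := R :* (a :* p)) refl (alt r * g (ι (i r))) (ι Rs) (P ν k i r) ⟩
      ι Rs * (alt r * g (ι (i r)) * P ν k i r) ∎
    inner : Σℚ (suc k) (λ r → alt (inject₁ r) * g (ι (x r)) * P ν k i (inject₁ r)) ≡ - 1ℚ * g (ι ν)
    inner = trans
      (Σ-cong (suc k) (λ r → trans (cong₂ (λ a p → a * g (ι (x r)) * p) (alt-inject₁ r) (P-nodes r))
        (solve 3 (λ a g p → (:- a) :* g :* p := (:- con 1ℚ) :* (a :* g :* p)) refl (alt r) (g (ι (x r))) (absBasis r ν))))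
      (trans (Σ-*ˡ (suc k) (- 1ℚ) (λ r → alt r * g (ι (x r)) * absBasis r ν)) (cong (- 1ℚ *_) (sym (lagrange-abs G))))

  k+[ν∸k]≡ν : k ℕ.+ (ν ∸ k) ≡ ν
  k+[ν∸k]≡ν = ℕₚ.m+[n∸m]≡n (ℕₚ.≤-trans k≤d (ℕₚ.<⇒≤ d<ν))

  extract-↭ : ∀ (c : Fin k → Fin ν) → Injective _≡_ _≡_ c → extract c N ↭ extract c D
  extract-↭ c c-inj = counts⇒↭ (extract c N) (extract c D) (λ u →
    trans (count-extract fN u) (trans (balanced u) (sym (count-extract fD u))))
    where
    n = ν ∸ k
    count-extract : ∀ f u → count (extract c (build ν (λ w → f (weight w)))) u ≡ T n (weight u) (λ j → ι (f j))
    count-extract f u = trans (sumL-map (λ v → ind v u) (pick c) (build ν (λ w → f (weight w))))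
      (trans (sumL-build ν (λ w → f (weight w)) (λ w → ind (pick c w) u)) (S-pick′ k+[ν∸k]≡ν c c-inj u (λ j → ι (f j))))
    balanced : ∀ u → T n (weight u) (λ j → ι (fN j)) ≡ T n (weight u) (λ j → ι (fD j))
    balanced u = -≡0⇒≡ (begin
      TN - TD
        ≡⟨ solve 2 (λ p q → p :- q := p :+ (:- con 1ℚ) :* q) refl TN TD ⟩
      TN + - 1ℚ * TD
        ≡⟨ cong (TN +_) (S-*ˡ n (- 1ℚ) (λ w → ι (fD (weight u ℕ.+ weight w)))) ⟨
      TN + S n (λ w → - 1ℚ * ι (fD (weight u ℕ.+ weight w)))
        ≡⟨ S-+ n (λ w → ι (fN (weight u ℕ.+ weight w))) (λ w → - 1ℚ * ι (fD (weight u ℕ.+ weight w))) ⟨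
      S n (λ w → ι (fN (weight u ℕ.+ weight w)) + - 1ℚ * ι (fD (weight u ℕ.+ weight w)))
        ≡⟨ S-cong n (λ w → solve 2 (λ p q → p :+ (:- con 1ℚ) :* q := con 1ℚ :* (p :- q)) refl
             (ι (fN (weight u ℕ.+ weight w))) (ι (fD (weight u ℕ.+ weight w)))) ⟩
      -- With all `k` columns fixed, degree 0 is left, so the test polynomial is the constant 1.
      T n (weight u) (λ j → 1ℚ * sig j)
        ≡⟨ T-annihilate sig sig-orthogonal k (weight u) (λ _ → 1ℚ) k+[ν∸k]≡ν (ℕₚ.+-identityʳ k)
             (weight≤length u) (Poly-const 0 1ℚ) ⟩
      0ℚ ∎)
      where
      open ≡-Reasoning
      TN = T n (weight u) (λ j → ι (fN j))
      TD = T n (weight u) (λ j → ι (fD j))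

  Rstar≡Rs : Rstar N D ≡ Rs
  Rstar≡Rs = trans (occ-build ν (λ w → fN (weight w)) (ones ν)) (trans
    (cong fN (trans (weight-ones ν) (sym i-last)))
    (trans (proj₁ (inN-node (fromℕ (suc k)) (last-parity k)))
      (ι-injective (trans (sym (proj₂ (multiplicity (fromℕ (suc k))))) mult-last))))

  ones∈N : ones ν ∈ N
  ones∈N = count≢0⇒∈ N (λ c≡0 → >⇒≢0 (0<ι 1≤Rs) (trans (cong ι (sym Rstar≡Rs)) (trans (occ-count N (ones ν)) c≡0)))

  weight-D : All (λ w → weight w ℕ.≤ d) D
  weight-D = All.tabulate (λ {w} w∈D → bound w (λ f≡0 →
    >⇒≢0 (∈⇒0<count w∈D) (trans (count-build ν (λ v → fD (weight v)) w) (cong ι f≡0))))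
    where
    node-bound : ∀ r → inD r ≡ true → i r ℕ.≤ d
    node-bound = fromℕ-inject₁-elim (λ r → inD r ≡ true → i r ℕ.≤ d)
      (λ on → contradiction (trans (sym on) (inD-false (fromℕ (suc k)) (last-parity k))) λ ())
      (λ s _ → x≤d s)
    bound : ∀ w → fD (weight w) ≢ 0 → weight w ℕ.≤ d
    bound w f≢0 = let (r , eq , on) = profile-support i M inD (weight w) f≢0 in
      subst (ℕ._≤ d) (sym eq) (node-bound r on)

  inΔ : InΔ ν d k N D
  inΔ = ones∈N , weight-D , extract-↭

  regular-build : ∀ f → Regular (build ν (λ w → f (weight w)))
  regular-build f w w′ eq = trans (occ-build ν (λ v → f (weight v)) w)
    (trans (cong f eq) (sym (occ-build ν (λ v → f (weight v)) w′)))

  occ-node : ∀ r w → weight w ≡ i r →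
    ((toℕ r % 2 ≡ k % 2) → (ℕtoℚ (occ D w) ≡ mult ν k i Rs r) × (occ N w ≡ 0))
    × ((toℕ r % 2 ≢ k % 2) → (ℕtoℚ (occ N w) ≡ mult ν k i Rs r) × (occ D w ≡ 0))
  occ-node r w eq =
    (λ h → trans (cong ι (trans occD (proj₁ (inD-node r h)))) (sym (proj₂ (multiplicity r))) , trans occN (proj₂ (inD-node r h))) ,
    (λ h → trans (cong ι (trans occN (proj₁ (inN-node r h)))) (sym (proj₂ (multiplicity r))) , trans occD (proj₂ (inN-node r h)))
    where
    occN : occ N w ≡ fN (i r)
    occN = trans (occ-build ν (λ v → fN (weight v)) w) (cong fN eq)
    occD : occ D w ≡ fD (i r)
    occD = trans (occ-build ν (λ v → fD (weight v)) w) (cong fD eq)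

  occ-off : ∀ w → (∀ r → weight w ≢ i r) → (occ N w ≡ 0) × (occ D w ≡ 0)
  occ-off w h = trans (occ-build ν (λ v → fN (weight v)) w) (profile-off i M inN (weight w) h) ,
                trans (occ-build ν (λ v → fD (weight v)) w) (profile-off i M inD (weight w) h)

  -- Extraction preserves the number of rows, so a single choice of `k` columns suffices.
  length-N≡length-D : length N ≡ length D
  length-N≡length-D = trans (sym (Listₚ.length-map (pick c) N)) (trans
    (↭ₚ.↭-length (extract-↭ c (Finₚ.inject≤-injective _ _ _ _))) (Listₚ.length-map (pick c) D))
    where
    c : Fin k → Fin ν
    c j = Fin.inject≤ j (ℕₚ.≤-trans k≤d (ℕₚ.<⇒≤ d<ν))

  -- Each node weight is used by exactly one of the two arrays, so adding the lengths removes the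
  -- alternating signs; the summand 1 comes from weight `ν`.
  length-N+length-D : ι (length N) + ι (length D) ≡ ι Rs * (1ℚ + ΣP)
  length-N+length-D = begin
    ι (length N) + ι (length D)
      ≡⟨ cong₂ _+_ (size fN) (size fD) ⟩
    S ν (λ w → ι (fN (weight w))) + S ν (λ w → ι (fD (weight w)))
      ≡⟨ S-+ ν (λ w → ι (fN (weight w))) (λ w → ι (fD (weight w))) ⟨
    S ν (λ w → total (weight w))
      ≡⟨ S-by-weight ν i i-distinct total (λ j h → cong₂ (λ p q → ι p + ι q) (profile-off i M inN j h) (profile-off i M inD j h)) ⟩
    Σℚ (suc (suc k)) (λ r → ι (ν C i r) * total (i r))
      ≡⟨ Σ-cong (suc (suc k)) (λ r → trans (cong (ι (ν C i r) *_) (total-node r (toℕ r % 2 ℕ.≟ k % 2))) (C*M r)) ⟩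
    Σℚ (suc (suc k)) (λ r → ι Rs * P ν k i r)
      ≡⟨ Σ-*ˡ (suc (suc k)) (ι Rs) (P ν k i) ⟩
    ι Rs * Σℚ (suc (suc k)) (P ν k i)
      ≡⟨ cong (ι Rs *_) (trans (Σ-last (suc k) (P ν k i)) (trans (cong (ΣP +_) P-last) (ℚₚ.+-comm ΣP 1ℚ))) ⟩
    ι Rs * (1ℚ + ΣP) ∎
    where
    open ≡-Reasoning
    total : ℕ → ℚ
    total j = ι (fN j) + ι (fD j)
    size : ∀ f → ι (length (build ν (λ w → f (weight w)))) ≡ S ν (λ w → ι (f (weight w)))
    size f = trans (sym (sumL-1 (build ν (λ w → f (weight w))))) (trans
      (sumL-build ν (λ w → f (weight w)) (λ _ → 1ℚ)) (S-cong ν (λ w → ℚₚ.*-identityʳ (ι (f (weight w))))))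
    total-node : ∀ r → Dec (toℕ r % 2 ≡ k % 2) → total (i r) ≡ ι (M r)
    total-node r (yes h) = trans (cong₂ (λ p q → ι p + ι q) (proj₂ (inD-node r h)) (proj₁ (inD-node r h))) (ℚₚ.+-identityˡ (ι (M r)))
    total-node r (no  h) = trans (cong₂ (λ p q → ι p + ι q) (proj₁ (inN-node r h)) (proj₂ (inN-node r h))) (ℚₚ.+-identityʳ (ι (M r)))

  -- The arrays have equally many rows, so twice the length of `D` is the total `Rs * (1 + ΣP)`.
  -- This is the origin of the 2 in `value`.
  ratio≡value : ratio N D ≡ value ν k i
  ratio≡value = *-cancelʳ (>⇒≢0 0<1+ΣP) (*-cancelʳ (>⇒≢0 (0<ι 0<length-D)) (begin
    ratio N D * (1ℚ + ΣP) * ι (length D)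
      ≡⟨ solve 3 (λ r p l → r :* p :* l := r :* l :* p) refl (ratio N D) (1ℚ + ΣP) (ι (length D)) ⟩
    ratio N D * ι (length D) * (1ℚ + ΣP)
      ≡⟨ cong (_* (1ℚ + ΣP)) (trans (/ℕ-* (Rstar N D) 0<length-D) (cong ι Rstar≡Rs)) ⟩
    ι Rs * (1ℚ + ΣP)
      ≡⟨ length-N+length-D ⟨
    ι (length N) + ι (length D)
      ≡⟨ cong (λ z → ι z + ι (length D)) length-N≡length-D ⟩
    ι (length D) + ι (length D)
      ≡⟨ solve 1 (λ l → l :+ l := (con 1ℚ :+ con 1ℚ) :* l) refl (ι (length D)) ⟩
    ι 2 * ι (length D)
      ≡⟨ cong (_* ι (length D)) value-* ⟨
    value ν k i * (1ℚ + ΣP) * ι (length D) ∎))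
    where
    open ≡-Reasoning
    ∈⇒0<length : ∀ {A : Set} {y : A} {ys : List A} → y ∈ ys → 0 ℕ.< length ys
    ∈⇒0<length (here _)  = s≤s z≤n
    ∈⇒0<length (there _) = s≤s z≤n
    0<length-D : 0 ℕ.< length D
    0<length-D = subst (0 ℕ.<_) length-N≡length-D (∈⇒0<length ones∈N)

-- Moments of a pair in Δ

-- Pigeonhole: if every column were hit, choosing preimages would inject `Fin ν` into the smaller
-- `Fin m`.
fresh : ∀ {m ν} → m ℕ.< ν → (c : Fin m → Fin ν) → ∃[ j ] (∀ t → c t ≢ j)
fresh {m} {ν} m<ν c with Finₚ.¬∀⟶∃¬ ν (λ j → ∃[ t ] c t ≡ j) (λ j → Finₚ.any? (λ t → c t Fin.≟ j)) not-onto
  where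
  not-onto : ¬ (∀ j → ∃[ t ] c t ≡ j)
  not-onto onto = ℕₚ.<⇒≱ m<ν (Finₚ.injective⇒≤ {f = λ j → proj₁ (onto j)}
    (λ {a} {b} eq → trans (sym (proj₂ (onto a))) (trans (cong c eq) (proj₂ (onto b)))))
... | j , ∄t = j , λ t eq → ∄t (t , eq)

consᶠ : ∀ {m} {A : Set} → A → (Fin m → A) → Fin (suc m) → A
consᶠ a c zero    = a
consᶠ a c (suc t) = c t

consᶠ-injective : ∀ {m ν} {c : Fin m → Fin ν} {j} → Injective _≡_ _≡_ c → (∀ t → c t ≢ j) → Injective _≡_ _≡_ (consᶠ j c)
consᶠ-injective c-inj j∉c {zero}  {zero}  eq = refl
consᶠ-injective c-inj j∉c {zero}  {suc t} eq = contradiction (sym eq) (j∉c t)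
consᶠ-injective c-inj j∉c {suc t} {zero}  eq = contradiction eq (j∉c t)
consᶠ-injective c-inj j∉c {suc t} {suc u} eq = cong suc (c-inj eq)

-- `InΔ` speaks of exactly `k` distinct columns, while expanding powers of the weight produces
-- shorter lists and repeated columns. Gaps and repetitions are filled with fresh columns.
cover : ∀ {ν} m (cs : List (Fin ν)) → length cs ℕ.≤ m → m ℕ.≤ ν →
  Σ (Fin m → Fin ν) λ c → (Injective _≡_ _≡_ c × (∀ {j} → j ∈ cs → ∃[ t ] c t ≡ j))
cover {ν} zero [] _ _ = (λ ()) , (λ { {()} }) , (λ ())
cover (suc m) [] _ m<ν with cover m [] z≤n (ℕₚ.<⇒≤ m<ν)
... | c , c-inj , _ with fresh m<ν c
... | j′ , j′∉c = consᶠ j′ c , consᶠ-injective c-inj j′∉c , (λ ())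
cover (suc m) (j ∷ cs) (s≤s l≤m) m<ν with cover m cs l≤m (ℕₚ.<⇒≤ m<ν)
... | c , c-inj , covers with Finₚ.any? (λ t → c t Fin.≟ j)
...   | no ∄t = consᶠ j c , consᶠ-injective c-inj (λ t eq → ∄t (t , eq)) ,
  λ { (here refl) → zero , refl ; (there j∈cs) → let (t , eq) = covers j∈cs in suc t , eq }
...   | yes (t₀ , eq₀) with fresh m<ν c
...     | j′ , j′∉c = consᶠ j′ c , consᶠ-injective c-inj j′∉c ,
  λ { (here refl) → suc t₀ , eq₀ ; (there j∈cs) → let (t , eq) = covers j∈cs in suc t , eq }

bit : Bool → ℚ
bit true  = 1ℚ
bit false = 0ℚ

weight-Σ : ∀ {n} (w : Word n) → ι (weight w) ≡ Σℚ n (λ j → bit (lookup w j))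
weight-Σ []          = refl
weight-Σ (true ∷ w)  = trans (ι-suc (weight w)) (cong (1ℚ +_) (weight-Σ w))
weight-Σ (false ∷ w) = trans (sym (ℚₚ.+-identityˡ (ι (weight w)))) (cong (0ℚ +_) (weight-Σ w))

allOn : ∀ {ν} → List (Fin ν) → Word ν → ℚ
allOn []       w = 1ℚ
allOn (j ∷ cs) w = bit (lookup w j) * allOn cs w

allOn-pick : ∀ {ν m} (c : Fin m → Fin ν) cs → (∀ {j} → j ∈ cs → ∃[ t ] c t ≡ j) →
  Σ (Word m → ℚ) λ φ → ∀ w → allOn cs w ≡ φ (pick c w)
allOn-pick c []       covers = (λ _ → 1ℚ) , (λ _ → refl)
allOn-pick c (j ∷ cs) covers with covers (here refl) | allOn-pick c cs (λ h → covers (there h))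
... | t , refl | φ , eq = (λ v → bit (lookup v t) * φ v) ,
  λ w → cong₂ (λ b p → bit b * p) (sym (Vecₚ.lookup∘tabulate (λ u → lookup w (c u)) t)) (eq w)

sumL-+ : ∀ {A : Set} (F G : A → ℚ) xs → sumL (λ x → F x + G x) xs ≡ sumL F xs + sumL G xs
sumL-+ F G []       = refl
sumL-+ F G (x ∷ xs) = trans (cong ((F x + G x) +_) (sumL-+ F G xs))
  (solve 4 (λ a b c d → a :+ b :+ (c :+ d) := a :+ c :+ (b :+ d)) refl (F x) (G x) (sumL F xs) (sumL G xs))

sumL-*ˡ : ∀ {A : Set} c (F : A → ℚ) xs → sumL (λ x → c * F x) xs ≡ c * sumL F xs
sumL-*ˡ c F []       = sym (ℚₚ.*-zeroʳ c)
sumL-*ˡ c F (x ∷ xs) = trans (cong ((c * F x) +_) (sumL-*ˡ c F xs)) (sym (ℚₚ.*-distribˡ-+ c (F x) (sumL F xs)))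

sumL-0 : ∀ {A : Set} (xs : List A) → sumL (λ _ → 0ℚ) xs ≡ 0ℚ
sumL-0 []       = refl
sumL-0 (x ∷ xs) = trans (ℚₚ.+-identityˡ (sumL (λ _ → 0ℚ) xs)) (sumL-0 xs)

sumL-Σ : ∀ {A : Set} m (F : Fin m → A → ℚ) xs → sumL (λ x → Σℚ m (λ j → F j x)) xs ≡ Σℚ m (λ j → sumL (F j) xs)
sumL-Σ zero    F xs = sumL-0 xs
sumL-Σ (suc m) F xs = trans (sumL-+ (F zero) (λ x → Σℚ m (λ j → F (suc j) x)) xs)
  (cong (sumL (F zero) xs +_) (sumL-Σ m (λ j → F (suc j)) xs))

sumL-≤ : ∀ {A : Set} {F G : A → ℚ} {xs} → All (λ x → F x ≤ℚ G x) xs → sumL F xs ≤ℚ sumL G xs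
sumL-≤ All.[]       = ℚₚ.≤-refl
sumL-≤ (h All.∷ hs) = ℚₚ.+-mono-≤ h (sumL-≤ hs)

module Moments {ν k} (k≤ν : k ℕ.≤ ν) {N D : Array ν}
  (similar : ∀ (c : Fin k → Fin ν) → Injective _≡_ _≡_ c → extract c N ↭ extract c D) where

  allOn-moment : ∀ cs → length cs ℕ.≤ k → sumL (allOn cs) N ≡ sumL (allOn cs) D
  allOn-moment cs l≤k =
    let (c , c-inj , covers) = cover k cs l≤k k≤ν
        (φ , eq) = allOn-pick c cs covers
        side : ∀ A → sumL (allOn cs) A ≡ sumL φ (extract c A)
        side A = trans (sumL-cong eq A) (sym (sumL-map φ (pick c) A))
    in trans (side N) (trans (sumL-↭ φ (similar c c-inj)) (sym (side D)))

  -- Expanding the weight as a sum of coordinates trades one degree of g for one more column.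
  moment : ∀ n cs g → length cs ℕ.+ n ℕ.≤ k → Poly n g →
    sumL (λ w → allOn cs w * g (ι (weight w))) N ≡ sumL (λ w → allOn cs w * g (ι (weight w))) D
  moment zero cs g l≤k G = trans (side N) (trans (cong (g 0ℚ *_) (allOn-moment cs (subst (ℕ._≤ k) (ℕₚ.+-identityʳ (length cs)) l≤k))) (sym (side D)))
    where
    side : ∀ A → sumL (λ w → allOn cs w * g (ι (weight w))) A ≡ g 0ℚ * sumL (allOn cs) A
    side A = trans (sumL-cong (λ w → trans (cong (allOn cs w *_) (G (ι (weight w)) 0ℚ)) (ℚₚ.*-comm (allOn cs w) (g 0ℚ))) A)
      (sumL-*ˡ (g 0ℚ) (allOn cs) A)
  moment (suc n) cs g l≤k G = trans (side N) (trans
      (cong₂ (λ p q → g 0ℚ * p + q)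
        (allOn-moment cs (ℕₚ.≤-trans (ℕₚ.m≤m+n (length cs) (suc n)) l≤k))
        (Σ-cong ν (λ j → moment n (j ∷ cs) h (subst (ℕ._≤ k) (ℕₚ.+-suc (length cs) n) l≤k) H)))
      (sym (side D)))
    where
    h = proj₁ (G 0ℚ)
    H = proj₁ (proj₂ (G 0ℚ))
    expand : ∀ w → allOn cs w * g (ι (weight w))
      ≡ g 0ℚ * allOn cs w + Σℚ ν (λ j → allOn (j ∷ cs) w * h (ι (weight w)))
    expand w = begin
      e * g y                                             ≡⟨ cong (e *_) (proj₂ (proj₂ (G 0ℚ)) y) ⟩
      e * (g 0ℚ + (y - 0ℚ) * h y)                          ≡⟨ solve 4 (λ e g y h → e :* (g :+ (y :- con 0ℚ) :* h) := g :* e :+ e :* h :* y) refl e (g 0ℚ) y (h y) ⟩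
      g 0ℚ * e + e * h y * y                              ≡⟨ cong (λ z → g 0ℚ * e + e * h y * z) (weight-Σ w) ⟩
      g 0ℚ * e + e * h y * Σℚ ν (λ j → bit (lookup w j))  ≡⟨ cong (g 0ℚ * e +_) (Σ-*ˡ ν (e * h y) (λ j → bit (lookup w j))) ⟨
      g 0ℚ * e + Σℚ ν (λ j → e * h y * bit (lookup w j))  ≡⟨ cong (g 0ℚ * e +_) (Σ-cong ν (λ j → solve 3 (λ e h b → e :* h :* b := b :* e :* h) refl e (h y) (bit (lookup w j)))) ⟩
      g 0ℚ * e + Σℚ ν (λ j → allOn (j ∷ cs) w * h y)      ∎
      where
      open ≡-Reasoning
      e = allOn cs w
      y = ι (weight w)
    side : ∀ A → sumL (λ w → allOn cs w * g (ι (weight w))) A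
      ≡ g 0ℚ * sumL (allOn cs) A + Σℚ ν (λ j → sumL (λ w → allOn (j ∷ cs) w * h (ι (weight w))) A)
    side A = trans (sumL-cong expand A) (trans
      (sumL-+ (λ w → g 0ℚ * allOn cs w) (λ w → Σℚ ν (λ j → allOn (j ∷ cs) w * h (ι (weight w)))) A)
      (cong₂ _+_ (sumL-*ˡ (g 0ℚ) (allOn cs) A) (sumL-Σ ν (λ j w → allOn (j ∷ cs) w * h (ι (weight w))) A)))

  weight-moment : ∀ g → Poly k g → sumL (λ w → g (ι (weight w))) N ≡ sumL (λ w → g (ι (weight w))) D
  weight-moment g G = trans (side N) (trans (moment k [] g ℕₚ.≤-refl G) (sym (side D)))
    where
    side : ∀ A → sumL (λ w → g (ι (weight w))) A ≡ sumL (λ w → 1ℚ * g (ι (weight w))) A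
    side = sumL-cong (λ w → sym (ℚₚ.*-identityˡ (g (ι (weight w)))))

-- Weak duality with the test polynomial `1 + f`: all-ones rows contribute `1 + f(ν)` each, the
-- other rows of `N` can be discarded because of the lower bound, and each row of `D` contributes at
-- most 2.
Rstar-bound : ∀ {ν d k} → k ℕ.≤ ν → ∀ f → Poly k f →
  (∀ j → j ℕ.≤ ν → - 1ℚ ≤ℚ f (ι j)) → (∀ j → j ℕ.≤ d → f (ι j) ≤ℚ 1ℚ) →
  ∀ N D → InΔ ν d k N D → ι (Rstar N D) * (1ℚ + f (ι ν)) ≤ℚ ι 2 * ι (R N D)
Rstar-bound {ν} {d} {k} k≤ν f F lower upper N D (_ , weight-D , similar) = begin
  ι (occ N (ones ν)) * g (ι ν)                          ≡⟨ cong (_* g (ι ν)) (occ-count N (ones ν)) ⟩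
  count N (ones ν) * g (ι ν)                            ≡⟨ ℚₚ.*-comm (count N (ones ν)) (g (ι ν)) ⟩
  g (ι ν) * count N (ones ν)                            ≡⟨ sumL-*ˡ (g (ι ν)) (λ v → ind v (ones ν)) N ⟨
  sumL (λ w → g (ι ν) * ind w (ones ν)) N               ≤⟨ sumL-≤ (All.universal (λ w → row w (w ≟ʷ ones ν)) N) ⟩
  sumL (λ w → g (ι (weight w))) N                       ≡⟨ Moments.weight-moment k≤ν similar g (Poly-+ k (Poly-const k 1ℚ) F) ⟩
  sumL (λ w → g (ι (weight w))) D                       ≤⟨ sumL-≤ (All.map (λ {w} w≤d → ℚₚ.+-monoʳ-≤ 1ℚ (upper (weight w) w≤d)) weight-D) ⟩
  sumL (λ _ → 1ℚ + 1ℚ) D                                ≡⟨⟩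
  sumL (λ _ → ι 2 * 1ℚ) D                               ≡⟨ sumL-*ˡ (ι 2) (λ _ → 1ℚ) D ⟩
  ι 2 * sumL (λ _ → 1ℚ) D                               ≡⟨ cong (ι 2 *_) (sumL-1 D) ⟩
  ι 2 * ι (length D)                                    ∎
  where
  open ℚₚ.≤-Reasoning
  g : ℚ → ℚ
  g y = 1ℚ + f y
  0≤g : ∀ w → 0ℚ ≤ℚ g (ι (weight w))
  0≤g w = ℚₚ.+-monoʳ-≤ 1ℚ (lower (weight w) (weight≤length w))
  row : ∀ w → Dec (w ≡ ones ν) → g (ι ν) * ind w (ones ν) ≤ℚ g (ι (weight w))
  row w (yes refl) = ℚₚ.≤-reflexive (trans (cong (g (ι ν) *_) (ind-refl (ones ν)))
    (trans (ℚₚ.*-identityʳ (g (ι ν))) (cong (λ j → g (ι j)) (sym (weight-ones ν)))))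
  row w (no w≢1)  = ℚₚ.≤-trans (ℚₚ.≤-reflexive (trans (cong (g (ι ν) *_) (ind-≢ w (ones ν) w≢1)) (ℚₚ.*-zeroʳ (g (ι ν))))) (0≤g w)

-- The exchange argument

Sign : ℚ → Set
Sign a = a ≡ 1ℚ ⊎ a ≡ - 1ℚ

alt-sign : ∀ {n} (r : Fin n) → Sign (alt r)
alt-sign {suc n} zero = lem n
  where
  lem : ∀ n → Sign (±1 n)
  lem zero    = inj₁ refl
  lem (suc n) with lem n
  ... | inj₁ eq = inj₂ (cong -_ eq)
  ... | inj₂ eq = inj₁ (cong -_ eq)
alt-sign (suc r) = alt-sign r

<⇒≱ℚ : ∀ {p q} → p <ℚ q → ¬ (q ≤ℚ p)
<⇒≱ℚ p<q q≤p = ℚₚ.<-irrefl refl (ℚₚ.<-≤-trans p<q q≤p)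

0≤1 : 0ℚ ≤ℚ 1ℚ
0≤1 = ℚₚ.nonNegative⁻¹ 1ℚ

-1≤1 : - 1ℚ ≤ℚ 1ℚ
-1≤1 = ℚₚ.≤-trans (ℚₚ.neg-antimono-≤ 0≤1) 0≤1

sign≤1 : ∀ {a} → Sign a → a ≤ℚ 1ℚ
sign≤1 (inj₁ refl) = ℚₚ.≤-refl
sign≤1 (inj₂ refl) = -1≤1

sign*sign : ∀ {a b} → Sign a → Sign b → Sign (a * b)
sign*sign (inj₁ refl) (inj₁ refl) = inj₁ refl
sign*sign (inj₁ refl) (inj₂ refl) = inj₂ refl
sign*sign (inj₂ refl) (inj₁ refl) = inj₂ refl
sign*sign (inj₂ refl) (inj₂ refl) = inj₁ refl

±≤1⇒bounds : ∀ {a p} → Sign a → a * p ≤ℚ 1ℚ → - a * p ≤ℚ 1ℚ → - 1ℚ ≤ℚ p × p ≤ℚ 1ℚ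
±≤1⇒bounds {p = p} (inj₁ refl) h h′ =
  subst (- 1ℚ ≤ℚ_) (solve 1 (λ p → :- ((:- con 1ℚ) :* p) := p) refl p) (ℚₚ.neg-antimono-≤ h′) ,
  subst (_≤ℚ 1ℚ) (ℚₚ.*-identityˡ p) h
±≤1⇒bounds {p = p} (inj₂ refl) h h′ =
  subst (- 1ℚ ≤ℚ_) (solve 1 (λ p → :- ((:- con 1ℚ) :* p) := p) refl p) (ℚₚ.neg-antimono-≤ h) ,
  subst (_≤ℚ 1ℚ) (ℚₚ.*-identityˡ p) h′

locate : ∀ k (x : Fin (suc k) → ℕ) j → x zero ℕ.≤ j → j ℕ.< x (fromℕ k) →
  ∃[ r ] (x (inject₁ r) ℕ.≤ j × j ℕ.< x (suc r))
locate zero    x j x₀≤j j<x = contradiction x₀≤j (ℕₚ.<⇒≱ j<x)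
locate (suc k) x j x₀≤j j<x with j ℕ.<? x (suc zero)
... | yes j<x₁ = zero , x₀≤j , j<x₁
... | no  j≮x₁ with locate k (λ r → x (suc r)) j (ℕₚ.≮⇒≥ j≮x₁) j<x
...   | r , lo , hi = suc r , lo , hi

consᶠ-increasing : ∀ {n} {a : ℕ} {y : Fin n → ℕ} → (∀ s → a ℕ.< y s) → Increasing y → Increasing (consᶠ a y)
consᶠ-increasing a<y y-inc zero    (suc s) _         = a<y s
consᶠ-increasing a<y y-inc (suc r) (suc s) (s≤s r<s) = y-inc r s r<s

Increasing-≤ : ∀ {n} {y : Fin n → ℕ} → Increasing y → ∀ r s → toℕ r ℕ.≤ toℕ s → y r ℕ.≤ y s
Increasing-≤ {y = y} y-inc r s r≤s with ℕₚ.m≤n⇒m<n∨m≡n r≤s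
... | inj₁ r<s = ℕₚ.<⇒≤ (y-inc r s r<s)
... | inj₂ r≡s = ℕₚ.≤-reflexive (cong y (Finₚ.toℕ-injective r≡s))

module _ {n} (y : Fin n → ℕ) (t : Fin n) (j : ℕ) where

  replace : Fin n → ℕ
  replace s = if does (s Fin.≟ t) then j else y s

  replace-at : replace t ≡ j
  replace-at = cong (λ b → if b then j else y t) (dec-true (t Fin.≟ t) refl)

  replace-other : ∀ {s} → s ≢ t → replace s ≡ y s
  replace-other {s} s≢t = cong (λ b → if b then j else y s) (dec-false (s Fin.≟ t) s≢t)

  replace-increasing : Increasing y → (∀ s → s Fin.< t → y s ℕ.< j) → (∀ s → t Fin.< s → j ℕ.< y s) → Increasing replace
  replace-increasing y-inc below above r s r<s with r Fin.≟ t | s Fin.≟ t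
  ... | yes refl | yes refl = contradiction r<s (ℕₚ.<-irrefl refl)
  ... | yes refl | no  _    = above s r<s
  ... | no  _    | yes refl = below r r<s
  ... | no  _    | no  _    = y-inc r s r<s

module Chebyshev {k d ν} (i : Seq k) (adm : Admissible ν d k i) where

  open Nodes i adm

  p : ℚ → ℚ
  p = combine alt

  p-poly : Poly k p
  p-poly = combine-poly alt

  p-node : ∀ r → p (ι (x r)) ≡ alt r
  p-node = combine-node alt

  p-d : p (ι d) ≡ 1ℚ
  p-d = trans (cong (λ j → p (ι j)) (sym x-last)) (trans (p-node (fromℕ k)) (alt-fromℕ k))

  -- The prescribed values `alt` cancel the signs of the basis beyond the nodes, so the
  -- interpolation formula at `ν` becomes the unsigned sum.
  p-ν : p (ι ν) ≡ ΣP
  p-ν = trans (combine-abs alt) (Σ-cong (suc k) (λ r → trans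
    (cong₂ _*_ (alt² r) (sym (P-nodes r))) (ℚₚ.*-identityˡ (P ν k i (inject₁ r)))))

module Exchange {k d ν} (i : Seq k) (adm : Admissible ν d k i)
  (minimal : ∀ i′ (adm′ : Admissible ν d k i′) → Nodes.ΣP i adm ≤ℚ Nodes.ΣP i′ adm′) where

  open Nodes i adm
  open Chebyshev i adm

  -- Let `p′` belong to the sequence with node `t` moved to `j`. At the new nodes `p - p′` vanishes
  -- except at `j`, where `alt t` times it is `alt t * p(j) - 1`. Were this positive, `p(ν)` would
  -- exceed `p′(ν)`, against minimality.
  no-exchange : ∀ t j → t ≢ zero → t ≢ fromℕ k →
    (∀ s → s Fin.< t → x s ℕ.< j) → (∀ s → t Fin.< s → j ℕ.< x s) → j ℕ.< ν → alt t * p (ι j) ≤ℚ 1ℚ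
  no-exchange t j t≢0 t≢k below above j<ν = ℚₚ.≮⇒≥ (λ 1<p →
    <⇒≱ℚ (0<-⇒< (subst₂ (λ a b → 0ℚ <ℚ a - b) p-ν C′.p-ν (gain 1<p))) (minimal i′ adm′))
    where
    i′ : Seq k
    i′ = replace i (inject₁ t) j

    below′ : ∀ s → s Fin.< inject₁ t → i s ℕ.< j
    below′ = fromℕ-inject₁-elim (λ s → s Fin.< inject₁ t → i s ℕ.< j)
      (λ h → contradiction h (ℕₚ.<-asym (inject₁<fromℕ t)))
      (λ s h → below s (subst₂ ℕ._<_ (Finₚ.toℕ-inject₁ s) (Finₚ.toℕ-inject₁ t) h))

    above′ : ∀ s → inject₁ t Fin.< s → j ℕ.< i s
    above′ = fromℕ-inject₁-elim (λ s → inject₁ t Fin.< s → j ℕ.< i s)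
      (λ _ → subst (j ℕ.<_) (sym i-last) j<ν)
      (λ s h → above s (subst₂ ℕ._<_ (Finₚ.toℕ-inject₁ t) (Finₚ.toℕ-inject₁ s) h))

    adm′ : Admissible ν d k i′
    adm′ = trans (replace-other i (inject₁ t) j (λ eq → t≢0 (Finₚ.inject₁-injective (sym eq)))) (proj₁ adm)
         , replace-increasing i (inject₁ t) j i-inc below′ above′
         , trans (replace-other i (inject₁ t) j (λ eq → t≢k (Finₚ.inject₁-injective (sym eq)))) x-last
         , trans (replace-other i (inject₁ t) j Finₚ.fromℕ≢inject₁) i-last

    module N′ = Nodes i′ adm′
    module C′ = Chebyshev i′ adm′

    at : alt t * (p (ι (N′.x t)) - C′.p (ι (N′.x t))) ≡ alt t * p (ι j) - 1ℚ
    at = trans (cong₂ (λ a b → alt t * (p (ι a) - b)) (replace-at i (inject₁ t) j) (C′.p-node t))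
      (trans (solve 2 (λ a p → a :* (p :- a) := a :* p :- a :* a) refl (alt t) (p (ι j)))
             (cong (λ z → alt t * p (ι j) - z) (alt² t)))

    other : ∀ s → s ≢ t → alt s * (p (ι (N′.x s)) - C′.p (ι (N′.x s))) ≡ 0ℚ
    other s s≢t = trans
      (cong₂ (λ a b → alt s * (a - b))
        (trans (cong (λ z → p (ι z)) (replace-other i (inject₁ t) j (λ eq → s≢t (Finₚ.inject₁-injective eq)))) (p-node s))
        (C′.p-node s))
      (solve 1 (λ a → a :* (a :- a) := con 0ℚ) refl (alt s))

    gain : 1ℚ <ℚ alt t * p (ι j) → 0ℚ <ℚ p (ι ν) - C′.p (ι ν)
    gain 1<p = N′.alternating⇒pos (Poly-- k p-poly C′.p-poly) (λ s → nonNeg s (s Fin.≟ t)) t pos-at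
      where
      pos-at : 0ℚ <ℚ alt t * (p (ι (N′.x t)) - C′.p (ι (N′.x t)))
      pos-at = subst (0ℚ <ℚ_) (sym at) (<⇒0<- 1<p)
      nonNeg : ∀ s → Dec (s ≡ t) → 0ℚ ≤ℚ alt s * (p (ι (N′.x s)) - C′.p (ι (N′.x s)))
      nonNeg s (yes refl) = ℚₚ.<⇒≤ pos-at
      nonNeg s (no  s≢t)  = ℚₚ.≤-reflexive (sym (other s s≢t))

  -- The node `d` is replaced by `j` for the comparison only. At the other nodes `alt s * (p - 1)`
  -- is `1 - alt s`, which is nonnegative, so an excess at `j` would force `p(d)` above its value 1.
  right-end : ∀ j → (∀ s → s Fin.< fromℕ k → x s ℕ.< j) → j ℕ.< d → p (ι j) ≤ℚ 1ℚ
  right-end j below j<d = ℚₚ.≮⇒≥ (λ 1<p → ℚₚ.<-irrefl refl (subst (λ z → 0ℚ <ℚ z - 1ℚ) p-d (gain 1<p)))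
    where
    top = fromℕ k
    y : Fin (suc k) → ℕ
    y = replace x top j
    y-inc : Increasing y
    y-inc = replace-increasing x top j x-inc below
      (λ s h → contradiction (Finₚ.≤fromℕ s) (ℕₚ.<⇒≱ h))
    y<d : ∀ s → y s ℕ.< d
    y<d = fromℕ-inject₁-elim (λ s → y s ℕ.< d)
      (subst (ℕ._< d) (sym (replace-at x top j)) j<d)
      (λ s → subst (ℕ._< d) (sym (replace-other x top j (λ eq → Finₚ.fromℕ≢inject₁ (sym eq))))
        (subst (x (inject₁ s) ℕ.<_) x-last (x-inc (inject₁ s) top (inject₁<fromℕ s))))
    gain : 1ℚ <ℚ p (ι j) → 0ℚ <ℚ p (ι d) - 1ℚ
    gain 1<p = Lagrange.Beyond.alternating⇒pos y y-inc d y<d (Poly-- k p-poly (Poly-const k 1ℚ))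
      (fromℕ-inject₁-elim (λ s → 0ℚ ≤ℚ alt s * (p (ι (y s)) - 1ℚ)) (ℚₚ.<⇒≤ pos-top) nonNeg) top pos-top
      where
      pos-top : 0ℚ <ℚ alt top * (p (ι (y top)) - 1ℚ)
      pos-top = subst (0ℚ <ℚ_) (sym (trans
        (cong₂ (λ a b → a * (p (ι b) - 1ℚ)) (alt-fromℕ k) (replace-at x top j)) (ℚₚ.*-identityˡ (p (ι j) - 1ℚ)))) (<⇒0<- 1<p)
      nonNeg : ∀ s → 0ℚ ≤ℚ alt (inject₁ s) * (p (ι (y (inject₁ s))) - 1ℚ)
      nonNeg s = subst (0ℚ ≤ℚ_) (sym (trans
        (cong (λ z → a * (z - 1ℚ)) (trans (cong (λ z → p (ι z)) (replace-other x top j (λ eq → Finₚ.fromℕ≢inject₁ (sym eq)))) (p-node (inject₁ s))))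
        (trans (solve 1 (λ a → a :* (a :- con 1ℚ) := a :* a :- a) refl a) (cong (_- a) (alt² (inject₁ s))))))
        (≤⇒0≤- (sign≤1 (alt-sign (inject₁ s))))
        where a = alt (inject₁ s)

-- The node 0 stays, `j` is inserted after it and `d` is dropped to keep the number of nodes. With
-- `σ` the value of `p` at 0, the polynomial `σ - p` vanishes at 0 and weakly alternates on these
-- nodes, so an excess at `j` would give `p(d) < σ`, although `p(d)` is 1.
left-end : ∀ {k d ν} (i : Seq (suc k)) (adm : Admissible ν d (suc k) i) → let open Nodes i adm in
  ∀ j → x zero ℕ.< j → j ℕ.< x (suc zero) → alt {suc (suc k)} zero * Chebyshev.p i adm (ι j) ≤ℚ 1ℚ
left-end {k} {d} {ν} i adm j x₀<j j<x₁ = ℚₚ.≮⇒≥ (λ 1<p → <⇒≱ℚ (0<-⇒< (gain 1<p))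
    (subst (σ ≤ℚ_) (sym p-d) (sign≤1 (alt-sign {suc (suc k)} zero))))
  where
  open Nodes i adm
  open Chebyshev i adm
  τ = ±1 k
  σ = - τ
  tail : Fin k → ℕ
  tail s = x (suc (inject₁ s))
  tail-inc : Increasing tail
  tail-inc r s r<s = x-inc (suc (inject₁ r)) (suc (inject₁ s)) (s≤s (subst₂ ℕ._<_ (sym (Finₚ.toℕ-inject₁ r)) (sym (Finₚ.toℕ-inject₁ s)) r<s))
  j<tail : ∀ s → j ℕ.< tail s
  j<tail s = ℕₚ.<-≤-trans j<x₁ (Increasing-≤ x-inc (suc zero) (suc (inject₁ s)) (s≤s z≤n))
  y : Fin (suc (suc k)) → ℕ
  y = consᶠ (x zero) (consᶠ j tail)
  x₀<rest : ∀ s → x zero ℕ.< consᶠ j tail s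
  x₀<rest zero    = x₀<j
  x₀<rest (suc s) = ℕₚ.<-trans x₀<j (j<tail s)
  y-inc : Increasing y
  y-inc = consᶠ-increasing x₀<rest (consᶠ-increasing j<tail tail-inc)
  j<d : j ℕ.< d
  j<d = ℕₚ.<-≤-trans j<x₁ (x≤d (suc zero))
  y<d : ∀ s → y s ℕ.< d
  y<d zero          = ℕₚ.<-trans x₀<j j<d
  y<d (suc zero)    = j<d
  y<d (suc (suc s)) = subst (tail s ℕ.<_) x-last (x-inc (suc (inject₁ s)) (fromℕ (suc k)) (s≤s (inject₁<fromℕ s)))
  gain : 1ℚ <ℚ σ * p (ι j) → 0ℚ <ℚ σ - p (ι d)
  gain 1<p = Lagrange.Beyond.alternating⇒pos y y-inc d y<d (Poly-- (suc k) (Poly-const (suc k) σ) p-poly) nonNeg (suc zero) pos-j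
    where
    pos-j : 0ℚ <ℚ τ * (σ - p (ι j))
    pos-j = subst (0ℚ <ℚ_) (trans (cong (λ z → σ * p (ι j) - z) (sym (alt² {suc k} zero)))
      (solve 2 (λ t p → (:- t) :* p :- t :* t := t :* ((:- t) :- p)) refl τ (p (ι j)))) (<⇒0<- 1<p)
    nonNeg : ∀ s → 0ℚ ≤ℚ alt s * (σ - p (ι (y s)))
    nonNeg zero          = ℚₚ.≤-reflexive (sym (trans (cong (λ z → σ * (σ - z)) (p-node zero))
      (solve 1 (λ a → a :* (a :- a) := con 0ℚ) refl σ)))
    nonNeg (suc zero)    = ℚₚ.<⇒≤ pos-j
    -- The insertion shifts the old nodes by one place, so `p` takes the value `- alt s` here and
    -- the product is `1 - alt s * τ`.
    nonNeg (suc (suc s)) = subst (0ℚ ≤ℚ_) (sym (trans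
        (cong (λ z → alt s * (σ - z)) (trans (p-node (suc (inject₁ s))) (alt-inject₁ s)))
        (trans (solve 2 (λ a t → a :* ((:- t) :- (:- a)) := a :* a :- a :* t) refl (alt s) τ) (cong (_- alt s * τ) (alt² s)))))
      (≤⇒0≤- (sign≤1 (sign*sign (alt-sign s) (alt-sign {suc k} zero))))

-- The same expression as `Nodes.ΣP`, but free of an admissibility proof, so that it can be
-- minimised over a list of plain vectors.
cost : ∀ ν k → Seq k → ℚ
cost ν k i = Σℚ (suc k) (λ r → P ν k i (inject₁ r))

Minimal : ∀ ν d k → Seq k → Set
Minimal ν d k i = ∀ i′ → Admissible ν d k i′ → cost ν k i ≤ℚ cost ν k i′

-- Moving the node below the gap up to `j` keeps the order of the nodes; the immovable first node is
-- left to `left-end`.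
left-bound : ∀ {k d ν} (i : Seq k) (adm : Admissible ν d k i) → Minimal ν d k i → let open Nodes i adm in
  ∀ r j → x (inject₁ r) ℕ.< j → j ℕ.< x (suc r) → alt (inject₁ r) * Chebyshev.p i adm (ι j) ≤ℚ 1ℚ
left-bound {suc k} i adm minimal zero    j lo hi = left-end i adm j lo hi
left-bound {suc k} i adm minimal (suc r) j lo hi =
  Exchange.no-exchange i adm minimal (inject₁ (suc r)) j (λ ()) (λ eq → Finₚ.fromℕ≢inject₁ (sym eq))
    (λ s s<r → ℕₚ.<-trans (x-inc s (inject₁ (suc r)) s<r) lo)
    (λ s r<s → ℕₚ.<-≤-trans hi (Increasing-≤ x-inc (suc (suc r)) s (subst (ℕ._< toℕ s) (Finₚ.toℕ-inject₁ (suc r)) r<s)))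
    (ℕₚ.<-trans hi (x<ν (suc (suc r))))
  where open Nodes i adm

-- Here the node above the gap moves down to `j`; if that node is `d`, `right-end` takes over.
right-bound : ∀ {k d ν} (i : Seq k) (adm : Admissible ν d k i) → Minimal ν d k i → let open Nodes i adm in
  ∀ r j → x (inject₁ r) ℕ.< j → j ℕ.< x (suc r) → alt (suc r) * Chebyshev.p i adm (ι j) ≤ℚ 1ℚ
right-bound {k} {d} i adm minimal r j lo hi = by-position (suc r Fin.≟ fromℕ k)
  where
  open Nodes i adm
  open Chebyshev i adm
  below : ∀ s → s Fin.< suc r → x s ℕ.< j
  below s (s≤s s≤r) = ℕₚ.≤-<-trans (Increasing-≤ x-inc s (inject₁ r) (subst (toℕ s ℕ.≤_) (sym (Finₚ.toℕ-inject₁ r)) s≤r)) lo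
  by-position : Dec (suc r ≡ fromℕ k) → alt (suc r) * p (ι j) ≤ℚ 1ℚ
  by-position (yes eq) = subst (_≤ℚ 1ℚ)
    (sym (trans (cong (_* p (ι j)) (trans (cong alt eq) (alt-fromℕ k))) (ℚₚ.*-identityˡ (p (ι j)))))
    (Exchange.right-end i adm minimal j (λ s s<k → below s (subst (s Fin.<_) (sym eq) s<k)) (ℕₚ.<-≤-trans hi (x≤d (suc r))))
  by-position (no  ≢k) = Exchange.no-exchange i adm minimal (suc r) j (λ ()) ≢k below
    (λ s r<s → ℕₚ.<-trans hi (x-inc (suc r) s r<s)) (ℕₚ.<-trans hi (x<ν (suc r)))

-- The extremal polynomial as a certificate for the upper bound

sign-bounds : ∀ {a} → Sign a → - 1ℚ ≤ℚ a × a ≤ℚ 1ℚ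
sign-bounds (inj₁ refl) = -1≤1 , ℚₚ.≤-refl
sign-bounds (inj₂ refl) = ℚₚ.≤-refl , -1≤1

module Certificate {k d ν} (i : Seq k) (adm : Admissible ν d k i) (minimal : Minimal ν d k i) where

  open Nodes i adm
  open Chebyshev i adm

  Bounded : ℚ → Set
  Bounded q = - 1ℚ ≤ℚ q × q ≤ℚ 1ℚ

  -- The two ends of a gap carry opposite signs, so the two one-sided bounds control `p` from above
  -- and from below.
  between : ∀ r j → x (inject₁ r) ℕ.< j → j ℕ.< x (suc r) → Bounded (p (ι j))
  between r j lo hi = ±≤1⇒bounds (alt-sign (suc r)) (right-bound i adm minimal r j lo hi)
    (subst (λ a → a * p (ι j) ≤ℚ 1ℚ) (alt-inject₁ r) (left-bound i adm minimal r j lo hi))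

  at-node : ∀ {j} r → x r ≡ j → Bounded (p (ι j))
  at-node r refl = subst Bounded (sym (p-node r)) (sign-bounds (alt-sign r))

  bounded : ∀ j → j ℕ.≤ d → Bounded (p (ι j))
  bounded j j≤d = by-end (ℕₚ.m≤n⇒m<n∨m≡n j≤d)
    where
    by-end : j ℕ.< d ⊎ j ≡ d → Bounded (p (ι j))
    by-end (inj₂ j≡d) = at-node (fromℕ k) (trans x-last (sym j≡d))
    by-end (inj₁ j<d) = let (r , lo , hi) = locate k x j (subst (ℕ._≤ j) (sym (proj₁ adm)) z≤n) (subst (j ℕ.<_) (sym x-last) j<d) in
      by-node r hi (ℕₚ.m≤n⇒m<n∨m≡n lo)
      where
      by-node : ∀ r → j ℕ.< x (suc r) → x (inject₁ r) ℕ.< j ⊎ x (inject₁ r) ≡ j → Bounded (p (ι j))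
      by-node r hi (inj₁ lo) = between r j lo hi
      by-node r hi (inj₂ eq) = at-node (inject₁ r) eq

  -- At each node `alt r * p` is 1, so the sign principle applies past the last node.
  beyond : ∀ j → d ℕ.< j → 0ℚ ≤ℚ p (ι j)
  beyond j d<j = Lagrange.Beyond.alternating⇒nonNeg x x-inc j (λ r → ℕₚ.≤-<-trans (x≤d r) d<j) p-poly
    (λ r → subst (0ℚ ≤ℚ_) (sym (trans (cong (alt r *_) (p-node r)) (alt² r))) 0≤1)

  lower : ∀ j → - 1ℚ ≤ℚ p (ι j)
  lower j = by-range (j ℕ.≤? d)
    where
    by-range : Dec (j ℕ.≤ d) → - 1ℚ ≤ℚ p (ι j)
    by-range (yes j≤d) = proj₁ (bounded j j≤d)
    by-range (no  j≰d) = ℚₚ.≤-trans (ℚₚ.neg-antimono-≤ 0≤1) (beyond j (ℕₚ.≰⇒> j≰d))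

  0≤value : 0ℚ ≤ℚ value ν k i
  0≤value = ℚₚ.*-cancelʳ-≤-pos (1ℚ + ΣP) {{positive 0<1+ΣP}}
    (subst₂ _≤ℚ_ (sym (ℚₚ.*-zeroˡ (1ℚ + ΣP))) (sym value-*) (0≤ι 2))

  -- `value` is 2 divided by 1 plus the cost, so least cost means largest value.
  value-maximal : ∀ j → Admissible ν d k j → value ν k j ≤ℚ value ν k i
  value-maximal j adm′ = ℚₚ.*-cancelʳ-≤-pos (1ℚ + N′.ΣP) {{positive N′.0<1+ΣP}} (begin
    value ν k j * (1ℚ + N′.ΣP)  ≡⟨ N′.value-* ⟩
    ι 2                         ≡⟨ value-* ⟨
    value ν k i * (1ℚ + ΣP)     ≤⟨ ℚₚ.*-monoˡ-≤-nonNeg (value ν k i) {{nonNegative 0≤value}} (ℚₚ.+-monoʳ-≤ 1ℚ (minimal j adm′)) ⟩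
    value ν k i * (1ℚ + N′.ΣP)  ∎)
    where
    open ℚₚ.≤-Reasoning
    module N′ = Nodes j adm′

  /ℕ≤value : ∀ a b → ι a * (1ℚ + ΣP) ≤ℚ ι 2 * ι b → a /ℕ b ≤ℚ value ν k i
  -- Division by zero returns 0 by convention.
  /ℕ≤value a zero    h = 0≤value
  /ℕ≤value a (suc b) h = ℚₚ.*-cancelʳ-≤-pos (ι (suc b)) {{positive (0<ι-suc b)}}
    (ℚₚ.*-cancelʳ-≤-pos (1ℚ + ΣP) {{positive 0<1+ΣP}} (begin
      (a /ℕ suc b) * ι (suc b) * (1ℚ + ΣP)   ≡⟨ cong (_* (1ℚ + ΣP)) (/ℕ-* a {suc b} (s≤s z≤n)) ⟩
      ι a * (1ℚ + ΣP)                        ≤⟨ h ⟩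
      ι 2 * ι (suc b)                        ≡⟨ cong (_* ι (suc b)) value-* ⟨
      value ν k i * (1ℚ + ΣP) * ι (suc b)    ≡⟨ solve 3 (λ v q l → v :* q :* l := v :* l :* q) refl (value ν k i) (1ℚ + ΣP) (ι (suc b)) ⟩
      value ν k i * ι (suc b) * (1ℚ + ΣP)    ∎))
    where open ℚₚ.≤-Reasoning

  ratio≤value : k ℕ.≤ ν → ∀ N D → InΔ ν d k N D → ratio N D ≤ℚ value ν k i
  ratio≤value k≤ν N D inΔ = /ℕ≤value (Rstar N D) (R N D)
    (subst (λ z → ι (Rstar N D) * (1ℚ + z) ≤ℚ ι 2 * ι (R N D)) p-ν
      (Rstar-bound k≤ν p p-poly (λ j _ → lower j) (λ j j≤d → proj₂ (bounded j j≤d)) N D inΔ))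

-- Existence of a minimal admissible sequence

-- Admissible sequences are bounded by `ν`, so the search for a minimiser is finite; vectors replace
-- functions so that the candidates can be listed.
boundedVecs : ∀ n → ℕ → List (Vec ℕ n)
boundedVecs zero    B = [] ∷ []
boundedVecs (suc n) B = List.cartesianProductWith _∷_ (List.upTo (suc B)) (boundedVecs n B)

∈-boundedVecs : ∀ n {B} (f : Fin n → ℕ) → (∀ r → f r ℕ.≤ B) → tabulate f ∈ boundedVecs n B
∈-boundedVecs zero    f f≤B = here refl
∈-boundedVecs (suc n) f f≤B = ∈-cartesianProductWith⁺ _∷_ (∈-upTo⁺ (s≤s (f≤B zero))) (∈-boundedVecs n (λ r → f (suc r)) (λ r → f≤B (suc r)))

admissible? : ∀ ν d k i → Dec (Admissible ν d k i)
admissible? ν d k i = (i zero ℕ.≟ 0)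
  ×-dec Finₚ.all? (λ r → Finₚ.all? (λ s → (r Finₚ.<? s) →-dec (i r ℕ.<? i s)))
  ×-dec (i (inject₁ (fromℕ k)) ℕ.≟ d)
  ×-dec (i (fromℕ (suc k)) ℕ.≟ ν)

-- Tabulating a sequence and looking it up again returns it only up to pointwise equality.
Admissible-resp : ∀ {ν d k} {i j : Seq k} → (∀ r → i r ≡ j r) → Admissible ν d k i → Admissible ν d k j
Admissible-resp i≗j (i₀ , i-inc , i-d , i-ν) =
  trans (sym (i≗j _)) i₀ ,
  (λ r s r<s → subst₂ ℕ._<_ (i≗j r) (i≗j s) (i-inc r s r<s)) ,
  trans (sym (i≗j _)) i-d ,
  trans (sym (i≗j _)) i-ν

cost-cong : ∀ ν k {i j : Seq k} → (∀ r → i r ≡ j r) → cost ν k i ≡ cost ν k j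
cost-cong ν k i≗j = Σ-cong (suc k) (λ r → Π-cong (suc k) (λ s →
  cong₂ (λ a b → if does (inject₁ s Fin.≟ inject₁ r) then 1ℚ else ((ν ∸ b) /ℕ ∣ a - b ∣)) (i≗j (inject₁ r)) (i≗j (inject₁ s))))

-- The sequence `0, 1, ..., k-1, d, ν`, the simplest admissible one; it shows that the maximum is
-- taken over a nonempty set.
staircase : ℕ → ℕ → ℕ → ℕ → ℕ
staircase k d ν m with ℕₚ.<-cmp m k
... | tri< _ _ _ = m
... | tri≈ _ _ _ = d
... | tri> _ _ _ = ν

staircase-< : ∀ {k d ν m} → m ℕ.< k → staircase k d ν m ≡ m
staircase-< {k} {m = m} m<k with ℕₚ.<-cmp m k
... | tri< _ _ _   = refl
... | tri≈ m≮k _ _ = contradiction m<k m≮k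
... | tri> m≮k _ _ = contradiction m<k m≮k

staircase-≡ : ∀ {k d ν m} → m ≡ k → staircase k d ν m ≡ d
staircase-≡ {k} {m = m} m≡k with ℕₚ.<-cmp m k
... | tri< _ m≢k _ = contradiction m≡k m≢k
... | tri≈ _ _ _   = refl
... | tri> _ m≢k _ = contradiction m≡k m≢k

staircase-> : ∀ {k d ν m} → k ℕ.< m → staircase k d ν m ≡ ν
staircase-> {k} {m = m} k<m with ℕₚ.<-cmp m k
... | tri< _ _ k≮m = contradiction k<m k≮m
... | tri≈ _ _ k≮m = contradiction k<m k≮m
... | tri> _ _ _   = refl

staircase-mono : ∀ {k d ν} → k ℕ.≤ d → d ℕ.< ν → ∀ {a b} → a ℕ.< b → b ℕ.≤ suc k → staircase k d ν a ℕ.< staircase k d ν b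
staircase-mono {k} {d} {ν} k≤d d<ν {a} {b} a<b b≤k+1 with ℕₚ.<-cmp a k | ℕₚ.<-cmp b k
... | tri< _ _ _   | tri< _ _ _    = a<b
... | tri< a<k _ _ | tri≈ _ _ _    = ℕₚ.<-≤-trans a<k k≤d
... | tri< a<k _ _ | tri> _ _ _    = ℕₚ.<-trans (ℕₚ.<-≤-trans a<k k≤d) d<ν
... | tri≈ _ refl _ | tri< b<k _ _ = contradiction a<b (ℕₚ.<-asym b<k)
... | tri≈ _ refl _ | tri≈ _ refl _ = contradiction a<b (ℕₚ.<-irrefl refl)
... | tri≈ _ _ _   | tri> _ _ _    = d<ν
... | tri> _ _ k<a | _             = contradiction (ℕₚ.<-≤-trans a<b b≤k+1) (ℕₚ.≤⇒≯ k<a)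

first : ∀ {k d ν} → 1 ℕ.≤ k → k ℕ.≤ d → d ℕ.< ν → Σ (Seq k) (Admissible ν d k)
first {k} {d} {ν} 1≤k k≤d d<ν = (λ r → staircase k d ν (toℕ r)) ,
  staircase-< 1≤k ,
  (λ r s r<s → staircase-mono k≤d d<ν r<s (ℕ.s≤s⁻¹ (Finₚ.toℕ<n s))) ,
  staircase-≡ (trans (Finₚ.toℕ-inject₁ (fromℕ k)) (Finₚ.toℕ-fromℕ k)) ,
  staircase-> (s≤s (ℕₚ.≤-reflexive (sym (Finₚ.toℕ-fromℕ k))))

minimizer : ∀ {k d ν} → 1 ℕ.≤ k → k ℕ.≤ d → d ℕ.< ν → Σ (Seq k) λ i → Admissible ν d k i × Minimal ν d k i
minimizer {k} {d} {ν} 1≤k k≤d d<ν = lookup best , best-admissible , best-minimal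
  where
  start = first 1≤k k≤d d<ν
  adm? : ∀ v → Dec (Admissible ν d k (lookup v))
  adm? v = admissible? ν d k (lookup v)
  candidates : List (Vec ℕ (suc (suc k)))
  candidates = List.filter adm? (boundedVecs (suc (suc k)) ν)
  f : Vec ℕ (suc (suc k)) → ℚ
  f v = cost ν k (lookup v)
  -- `argmin` may return its default, which therefore has to be admissible.
  v₀ : Vec ℕ (suc (suc k))
  v₀ = tabulate (proj₁ start)
  best : Vec ℕ (suc (suc k))
  best = argmin f v₀ candidates
  best-admissible : Admissible ν d k (lookup best)
  best-admissible = argmin-all f {P = λ v → Admissible ν d k (lookup v)}
    (Admissible-resp (λ r → sym (Vecₚ.lookup∘tabulate (proj₁ start) r)) (proj₂ start))
    (Allₚ.all-filter adm? (boundedVecs (suc (suc k)) ν))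
  best-minimal : Minimal ν d k (lookup best)
  best-minimal i adm = subst (cost ν k (lookup best) ≤ℚ_) (cost-cong ν k (Vecₚ.lookup∘tabulate i))
    (All.lookup (f[argmin]≤f[xs] {f = f} v₀ candidates) (∈-filter⁺ adm?
      (∈-boundedVecs (suc (suc k)) i (Nodes.i≤ν i adm))
      (Admissible-resp (λ r → sym (Vecₚ.lookup∘tabulate i r)) adm)))

-- Clearing denominators

ι-* : ∀ m n → ι (m ℕ.* n) ≡ ι m * ι n
ι-* zero    n = sym (ℚₚ.*-zeroˡ (ι n))
ι-* (suc m) n = trans (ι-+ n (m ℕ.* n)) (trans (cong (ι n +_) (ι-* m n)) (trans
  (solve 2 (λ m n → n :+ m :* n := (con 1ℚ :+ m) :* n) refl (ι m) (ι n)) (cong (_* ι n) (sym (ι-suc m)))))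

denominator : ∀ q → 0ℚ ≤ℚ q → ∃[ b ] ∃[ a ] (1 ℕ.≤ b × ι b * q ≡ ι a)
denominator q@(mkℚ (pos a) b _) _ = suc b , a , s≤s z≤n ,
  trans (ℚₚ.*-comm (ι (suc b)) q) (trans (cong (_* ι (suc b)) (sym (ℚₚ.↥p/↧p≡p q))) (/ℕ-* a {suc b} (s≤s z≤n)))
denominator (mkℚ ℤ.-[1+ _ ] _ _) (ℚ.*≤* ())

-- The product of the individual denominators is enough, as no least one is sought.
common-denominator : ∀ n (q : Fin n → ℚ) → (∀ r → 0ℚ ≤ℚ q r) → ∃[ b ] (1 ℕ.≤ b × (∀ r → ∃[ a ] ι b * q r ≡ ι a))
common-denominator zero    q 0≤q = 1 , s≤s z≤n , λ ()
common-denominator (suc n) q 0≤q with denominator (q zero) (0≤q zero) | common-denominator n (λ r → q (suc r)) (λ r → 0≤q (suc r))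
... | b , a , 1≤b , eq | c , 1≤c , eqs = b ℕ.* c , ℕₚ.*-mono-≤ 1≤b 1≤c , λ
  { zero    → c ℕ.* a , trans (cong (_* q zero) (ι-* b c)) (trans
      (solve 3 (λ b c q → b :* c :* q := c :* (b :* q)) refl (ι b) (ι c) (q zero))
      (trans (cong (ι c *_) eq) (sym (ι-* c a))))
  ; (suc r) → b ℕ.* proj₁ (eqs r) , trans (cong (_* q (suc r)) (ι-* b c)) (trans
      (ℚₚ.*-assoc (ι b) (ι c) (q (suc r)))
      (trans (cong (ι b *_) (proj₂ (eqs r))) (sym (ι-* b (proj₁ (eqs r)))))) }

-- `mult` is linear in `Rs`, so a common denominator of its values at `Rs = 1` works. Thus every
-- admissible sequence admits the construction for some `Rs`.
integral-multiple : ∀ {k d ν} (i : Seq k) → Admissible ν d k i →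
  ∃[ Rs ] (1 ℕ.≤ Rs × (∀ (r : Fin (suc k)) → ∃[ n ] (mult ν k i Rs (inject₁ r) ≡ ℕtoℚ n)))
integral-multiple {k} {d} {ν} i adm =
  let (b , 1≤b , eqs) = common-denominator (suc k) q 0≤q
  in b , 1≤b , λ r → proj₁ (eqs r) , trans (scale b r) (proj₂ (eqs r))
  where
  open Nodes i adm
  q : Fin (suc k) → ℚ
  q r = P ν k i (inject₁ r) /ℚ ι (ν C x r)
  q-* : ∀ r → q r * ι (ν C x r) ≡ P ν k i (inject₁ r)
  q-* r = /ℚ-* (P ν k i (inject₁ r)) (C≢0 (inject₁ r))
  0≤q : ∀ r → 0ℚ ≤ℚ q r
  0≤q r = ℚₚ.*-cancelʳ-≤-pos (ι (ν C x r)) {{positive (0<ι (0<C ν (x r) (i≤ν (inject₁ r))))}}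
    (subst₂ _≤ℚ_ (sym (ℚₚ.*-zeroˡ (ι (ν C x r)))) (sym (q-* r)) (ℚₚ.<⇒≤ (0<P r)))
  scale : ∀ b r → mult ν k i b (inject₁ r) ≡ ι b * q r
  scale b r = *-cancelʳ (C≢0 (inject₁ r)) (trans (/ℚ-* (ι b * P ν k i (inject₁ r)) (C≢0 (inject₁ r)))
    (sym (trans (ℚₚ.*-assoc (ι b) (q r) (ι (ν C x r))) (cong (ι b *_) (q-* r)))))

-- Regular pairs, attainment of the value, and optimality

regular-pair : ∀ {k d ν} → k ≤ d → d < ν → (i : Seq k) → Admissible ν d k i →
  ∀ (Rs : ℕ) → 1 ≤ Rs →
  (∀ (r : Fin (suc k)) → ∃[ n ] (mult ν k i Rs (inject₁ r) ≡ ℕtoℚ n)) →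
  ∃[ N ] ∃[ D ] (InΔ ν d k N D × Regular N × Regular D
    × (∀ (r : Fin (suc (suc k))) (w : Word ν) → weight w ≡ i r →
         ((toℕ r % 2 ≡ k % 2) → (ℕtoℚ (occ D w) ≡ mult ν k i Rs r) × (occ N w ≡ 0))
         × ((toℕ r % 2 ≢ k % 2) → (ℕtoℚ (occ N w) ≡ mult ν k i Rs r) × (occ D w ≡ 0)))
    × (∀ (w : Word ν) → (∀ r → weight w ≢ i r) → (occ N w ≡ 0) × (occ D w ≡ 0)))
regular-pair k≤d d<ν i adm Rs 1≤Rs integral =
  N , D , inΔ , regular-build fN , regular-build fD , occ-node , occ-off
  where open Construction k≤d d<ν i adm Rs 1≤Rs integral

value-attained : ∀ {k d ν} → k ≤ d → d < ν → (i : Seq k) → Admissible ν d k i →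
  ∃[ N ] ∃[ D ] (InΔ ν d k N D × ratio N D ≡ value ν k i)
value-attained {k} {d} {ν} k≤d d<ν i adm = from-scale (integral-multiple i adm)
  where
  from-scale : ∃[ Rs ] (1 ≤ Rs × (∀ (r : Fin (suc k)) → ∃[ n ] (mult ν k i Rs (inject₁ r) ≡ ℕtoℚ n))) →
    ∃[ N ] ∃[ D ] (InΔ ν d k N D × ratio N D ≡ value ν k i)
  from-scale (Rs , 1≤Rs , integral) = N , D , inΔ , ratio≡value
    where open Construction k≤d d<ν i adm Rs 1≤Rs integral

minimal⇒optimal : ∀ {k d ν} → k ≤ d → d < ν → (i : Seq k) → Admissible ν d k i → Minimal ν d k i →
  (∀ (j : Seq k) → Admissible ν d k j → value ν k j ≤ℚ value ν k i)
  × (∃[ N ] ∃[ D ] (InΔ ν d k N D × ratio N D ≡ value ν k i))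
  × (∀ N D → InΔ ν d k N D → ratio N D ≤ℚ value ν k i)
minimal⇒optimal k≤d d<ν i adm minimal =
  value-maximal , value-attained k≤d d<ν i adm , ratio≤value (ℕₚ.≤-trans k≤d (ℕₚ.<⇒≤ d<ν))
  where open Certificate i adm minimal

theorem5 : ∀ (k d ν : ℕ) → 1 ≤ k → k ≤ d → d < ν →
    (∀ (i : Seq k) → Admissible ν d k i →
    ∀ (Rs : ℕ) → 1 ≤ Rs →
    (∀ (r : Fin (suc k)) → ∃[ n ] (mult ν k i Rs (inject₁ r) ≡ ℕtoℚ n)) →
    ∃[ N ] ∃[ D ] (InΔ ν d k N D × Regular N × Regular D
    × (∀ (r : Fin (suc (suc k))) (w : Word ν) → weight w ≡ i r →
    ((toℕ r % 2 ≡ k % 2) → (ℕtoℚ (occ D w) ≡ mult ν k i Rs r) × (occ N w ≡ 0))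
    × ((toℕ r % 2 ≢ k % 2) → (ℕtoℚ (occ N w) ≡ mult ν k i Rs r) × (occ D w ≡ 0)))
    × (∀ (w : Word ν) → (∀ r → weight w ≢ i r) → (occ N w ≡ 0) × (occ D w ≡ 0))))
    × (∃[ i ] (Admissible ν d k i
    × (∀ (j : Seq k) → Admissible ν d k j → value ν k j ≤ℚ value ν k i)
    × (∃[ N ] ∃[ D ] (InΔ ν d k N D × ratio N D ≡ value ν k i))
    × (∀ N D → InΔ ν d k N D → ratio N D ≤ℚ value ν k i)))
theorem5 k d ν 1≤k k≤d d<ν =
  regular-pair k≤d d<ν ,
  (let (i , adm , minimal) = minimizer 1≤k k≤d d<ν in i , adm , minimal⇒optimal k≤d d<ν i adm minimal)
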